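{- Let $q>2$ be a prime power and $\nu\ge 1$ an integer. Regard $PSp_{2\nu}(\mathbb{F}_q)$ as a subgroup of $\mathrm{Aut}(Sp(2\nu,q))$, namely as the subgroup $\{\sigma_T : T\in Sp_{2\nu}(\mathbb{F}_q)\}$, and let $E$ be the subgroup $$E=\{\sigma\in \mathrm{Aut}(Sp(2\nu,q)):\ \sigma([e_i])=[e_i],\ \sigma([f_i])=[f_i],\ i=1,\ldots,\nu\}.$$ Then: (1) $\mathrm{Aut}(Sp(2\nu,q))=PSp_{2\nu}(\mathbb{F}_q)\cdot E$, i.e. every automorphism is a product of an element of $PSp_{2\nu}(\mathbb{F}_q)$ and an element of $E$; (2) if $\nu=1$, then $E$ is isomorphic to the symmetric group on $q-1$ elements; (3) if $\nu>1$, then $$E\cong \underbrace{(\mathbb{F}_q^*\times\cdots\times\mathbb{F}_q^*)}_{\nu}\rtimes_{\varphi}\mathrm{Aut}(\mathbb{F}_q).$$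
   Context: Let $\mathbb{F}_q$ be the finite field with $q$ elements, $\mathbb{F}_q^*=\mathbb{F}_q\setminus\{0\}$, and let $\mathbb{F}_q^{(2\nu)}$ be the $2\nu$-dimensional space of row vectors over $\mathbb{F}_q$. Let $K$ be the $2\nu\times 2\nu$ block diagonal matrix over $\mathbb{F}_q$ with $\nu$ diagonal blocks all equal to $\begin{pmatrix}0&1\\-1&0\end{pmatrix}$. For a nonzero row vector $\alpha$, $[\alpha]$ denotes the one-dimensional subspace spanned by $\alpha$. The symplectic graph $Sp(2\nu,q)$ is the simple undirected graph whose vertices are the one-dimensional subspaces of $\mathbb{F}_q^{(2\nu)}$, with $[\alpha]$ adjacent to $[\beta]$ if and only if $\alpha K\,{}^t\!\beta\neq 0$ (where ${}^t\!\beta$ is the transpose of $\beta$). $\mathrm{Aut}(Sp(2\nu,q))$ is its group of graph automorphisms. The vectors $e_1,f_1,e_2,f_2,\ldots,e_\nu,f_\nu$ are, in this order, the standard basis vectors of $\mathbb{F}_q^{(2\nu)}$ (so $e_i$ has a $1$ in position $2i-1$ and $f_i$ has a $1$ in position $2i$, zeros elsewhere). The symplectic group $Sp_{2\nu}(\mathbb{F}_q)$ is the group of $2\nu\times2\nu$ matrices $T$ over $\mathbb{F}_q$ with $TK\,{}^tT=K$. The projective symplectic group $PSp_{2\nu}(\mathbb{F}_q)$ is the quotient of $Sp_{2\nu}(\mathbb{F}_q)$ by the subgroup $\{I,-I\}$, where $I$ is the identity matrix. Each $T\in Sp_{2\nu}(\mathbb{F}_q)$ induces the graph automorphism $\sigma_T:[\alpha]\mapsto[\alpha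 T]$, and two matrices of $Sp_{2\nu}(\mathbb{F}_q)$ induce the same automorphism iff they are scalar multiples of each other, which is how $PSp_{2\nu}(\mathbb{F}_q)$ is regarded as a subgroup of $\mathrm{Aut}(Sp(2\nu,q))$. $\mathrm{Aut}(\mathbb{F}_q)$ is the group of field automorphisms of $\mathbb{F}_q$, and $\varphi$ is its natural action on $\mathbb{F}_q^*\times\cdots\times\mathbb{F}_q^*$ ($\nu$ factors), $\varphi(\pi)((k_1,\ldots,k_\nu))=(\pi(k_1),\ldots,\pi(k_\nu))$. The semidirect product $(\mathbb{F}_q^*\times\cdots\times\mathbb{F}_q^*)\rtimes_\varphi\mathrm{Aut}(\mathbb{F}_q)$ consists of the elements $(k_1,\ldots,k_\nu,\pi)$ with $k_i\in\mathbb{F}_q^*$, $\pi\in\mathrm{Aut}(\mathbb{F}_q)$, with multiplication $$(k_1,\ldots,k_\nu,\pi)(k_1',\ldots,k_\nu',\pi')=(k_1\pi(k_1'),\ldots,k_\nu\pi(k_\nu'),\pi\pi').$$ -}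

module Defs where

open import Algebra.Bundles using (Group; CommutativeRing)
import Algebra.Construct.Pointwise as Pointwise
open import Algebra.Definitions using (Invertible)
open import Algebra.Morphism.Structures using (module GroupMorphisms; module RingMorphisms)
import Algebra.Morphism.Construct.Composition as RingComposition
import Algebra.Morphism.Construct.Identity as RingIdentity
import Algebra.Properties.Group as GroupProperties
import Algebra.Properties.Ring as RingProperties
import Algebra.Properties.Semiring.Sum as Sum
open import Algebra.Structures using (IsCommutativeRing)
open import Data.Bool.Base using (if_then_else_)
open import Data.Empty using (⊥-elim)
open import Data.Fin.Base using (Fin; zero; suc; combine; remQuot)
open import Data.Fin.Properties using (_≟_)
open import Data.Nat.Base as ℕ using (ℕ; zero; suc)
open import Data.Nat.Primality using (Prime)
open import Data.Product.Base using (Σ; ∃; ∃₂; _×_; _,_; proj₁; proj₂)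
open import Data.Vec.Functional using (Vector; transpose)
open import Function.Base using (_∘_)
open import Function.Bundles using (Inverse; Equivalence; _⇔_; mk⇔)
import Function.Construct.Composition as Composition
import Function.Construct.Identity as Identity
import Function.Construct.Symmetry as Symmetry
open import Level using (Level; _⊔_) renaming (suc to lsuc)
open import Relation.Binary.Bundles using (Setoid)
open import Relation.Binary.Core using (Rel)
open import Relation.Binary.PropositionalEquality as ≡
  using (_≡_; _≢_; refl; sym; trans; cong; cong₂; module ≡-Reasoning)
open import Relation.Nullary.Decidable.Core using (does; yes; no)
open import Relation.Nullary.Negation.Core using (¬_)

private
  variable
    a b c ℓ ℓ₁ ℓ₂ p : Level

IsPrimePower : ℕ → Set
IsPrimePower q = ∃₂ λ p n → Prime p × 1 ℕ.≤ n × q ≡ p ℕ.^ n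

infix 4 _≅_

_≅_ : Group a ℓ₁ → Group b ℓ₂ → Set (a ⊔ b ⊔ ℓ₁ ⊔ ℓ₂)
G ≅ H = ∃ (GroupMorphisms.IsGroupIsomorphism (Group.rawGroup G) (Group.rawGroup H))

module _ (G : Group a ℓ) where
  open Group G

  record IsSubgroup (P : Carrier → Set p) : Set (a ⊔ p) where
    field
      ∙-closed  : ∀ {x y} → P x → P y → P (x ∙ y)
      ε-closed  : P ε
      ⁻¹-closed : ∀ {x} → P x → P (x ⁻¹)

  subgroup : {P : Carrier → Set p} → IsSubgroup P → Group (a ⊔ p) ℓ
  subgroup {P = P} isSubgroup = record
    { Carrier = Σ Carrier P
    ; _≈_     = λ x y → proj₁ x ≈ proj₁ y
    ; _∙_     = λ x y → proj₁ x ∙ proj₁ y , ∙-closed (proj₂ x) (proj₂ y)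
    ; ε       = ε , ε-closed
    ; _⁻¹     = λ x → proj₁ x ⁻¹ , ⁻¹-closed (proj₂ x)
    ; isGroup = record
      { isMonoid = record
        { isSemigroup = record
          { isMagma = record
            { isEquivalence = record
              { refl  = Group.refl G
              ; sym   = Group.sym G
              ; trans = Group.trans G
              }
            ; ∙-cong = ∙-cong
            }
          ; assoc = λ x y z → assoc (proj₁ x) (proj₁ y) (proj₁ z)
          }
        ; identity = (λ x → identityˡ (proj₁ x)) , (λ x → identityʳ (proj₁ x))
        }
      ; inverse = (λ x → inverseˡ (proj₁ x)) , (λ x → inverseʳ (proj₁ x))
      ; ⁻¹-cong = ⁻¹-cong
      }
    }
    where open IsSubgroup isSubgroup

-- The product of permutations is σ ∙ τ = σ ∘ τ (τ acts first).
Sym : Setoid a ℓ → Group (a ⊔ ℓ) (a ⊔ ℓ)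
Sym {a} {ℓ} S = record
  { Carrier = Inverse S S
  ; _≈_     = _≋_
  ; _∙_     = λ σ τ → Composition.inverse τ σ
  ; ε       = Identity.inverse S
  ; _⁻¹     = Symmetry.inverse
  ; isGroup = record
    { isMonoid = record
      { isSemigroup = record
        { isMagma = record
          { isEquivalence = record
            { refl  = λ _ → S.refl
            ; sym   = λ p x → S.sym (p x)
            ; trans = λ p q x → S.trans (p x) (q x)
            }
          ; ∙-cong = λ {σ} {σ′} {τ} {τ′} p q x →
              S.trans (Inverse.to-cong σ (q x)) (p (Inverse.to τ′ x))
          }
        ; assoc = λ _ _ _ _ → S.refl
        }
      ; identity = (λ _ _ → S.refl) , (λ _ _ → S.refl)
      }
    ; inverse = (λ σ x → Inverse.inverseʳ σ S.refl) , (λ σ x → Inverse.inverseˡ σ S.refl)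
    ; ⁻¹-cong = λ {σ} {τ} p x →
        Inverse.inverseʳ σ
          (S.trans (S.sym (Inverse.inverseˡ τ S.refl)) (S.sym (p (Inverse.from τ x))))
    }
  }
  where
  module S = Setoid S
  -- a bijection is determined by its forward map
  _≋_ : Rel (Inverse S S) (a ⊔ ℓ)
  σ ≋ τ = ∀ x → Inverse.to σ x S.≈ Inverse.to τ x

record Action (H : Group a ℓ₁) (N : Group b ℓ₂) : Set (a ⊔ b ⊔ ℓ₁ ⊔ ℓ₂) where
  private
    module H = Group H
    module N = Group N
  infixr 8 _▷_
  field
    _▷_     : H.Carrier → N.Carrier → N.Carrier
    ▷-cong  : ∀ {h h′ n n′} → h H.≈ h′ → n N.≈ n′ → (h ▷ n) N.≈ (h′ ▷ n′)
    ▷-homo  : ∀ h n n′ → (h ▷ (n N.∙ n′)) N.≈ ((h ▷ n) N.∙ (h ▷ n′))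
    ▷-comp  : ∀ h h′ n → ((h H.∙ h′) ▷ n) N.≈ (h ▷ (h′ ▷ n))
    ▷-ident : ∀ n → (H.ε ▷ n) N.≈ n

  ▷-ε : ∀ h → (h ▷ N.ε) N.≈ N.ε
  ▷-ε h = GroupProperties.identityʳ-unique N (h ▷ N.ε) (h ▷ N.ε)
    (N.trans (N.sym (▷-homo h N.ε N.ε)) (▷-cong H.refl (N.identityˡ N.ε)))

-- (n , h)(n′ , h′) = (n (h ▷ n′) , h h′)
semidirect : (N : Group b ℓ₂) (H : Group a ℓ₁) → Action H N → Group (a ⊔ b) (ℓ₁ ⊔ ℓ₂)
semidirect N H φ = record
  { Carrier = N.Carrier × H.Carrier
  ; _≈_     = λ (n , h) (n′ , h′) → n N.≈ n′ × h H.≈ h′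
  ; _∙_     = λ (n , h) (n′ , h′) → n N.∙ (h ▷ n′) , h H.∙ h′
  ; ε       = N.ε , H.ε
  ; _⁻¹     = λ (n , h) → (h H.⁻¹) ▷ (n N.⁻¹) , h H.⁻¹
  ; isGroup = record
    { isMonoid = record
      { isSemigroup = record
        { isMagma = record
          { isEquivalence = record
            { refl  = N.refl , H.refl
            ; sym   = λ (p , q) → N.sym p , H.sym q
            ; trans = λ (p , q) (p′ , q′) → N.trans p p′ , H.trans q q′
            }
          ; ∙-cong = λ (p , q) (p′ , q′) → N.∙-cong p (▷-cong q p′) , H.∙-cong q q′
          }
        ; assoc = λ (n , h) (n′ , h′) (n″ , h″) →
            N.trans (N.assoc _ _ _)
              (N.∙-congˡ (N.trans (N.∙-congˡ (▷-comp h h′ n″)) (N.sym (▷-homo h n′ (h′ ▷ n″)))))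
            , H.assoc h h′ h″
        }
      ; identity =
          (λ (n , h) → N.trans (N.identityˡ _) (▷-ident n) , H.identityˡ h)
        , (λ (n , h) → N.trans (N.∙-congˡ (▷-ε h)) (N.identityʳ n) , H.identityʳ h)
      }
    ; inverse =
        (λ (n , h) →
            N.trans (N.sym (▷-homo (h H.⁻¹) (n N.⁻¹) n))
              (N.trans (▷-cong H.refl (N.inverseˡ n)) (▷-ε (h H.⁻¹)))
          , H.inverseˡ h)
      , (λ (n , h) →
            N.trans
              (N.∙-congˡ
                (N.trans (N.sym (▷-comp h (h H.⁻¹) (n N.⁻¹)))
                  (N.trans (▷-cong (H.inverseʳ h) N.refl) (▷-ident (n N.⁻¹)))))
              (N.inverseʳ n)
          , H.inverseʳ h)
    ; ⁻¹-cong = λ (p , q) → ▷-cong (H.⁻¹-cong q) (N.⁻¹-cong p) , H.⁻¹-cong q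
    }
  }
  where
  module N = Group N
  module H = Group H
  open Action φ

syntax semidirect N H φ = N ⋊[ φ ] H

record SimpleGraph v ℓ e : Set (lsuc (v ⊔ ℓ ⊔ e)) where
  field
    vertices : Setoid v ℓ
  open Setoid vertices using (_≈_) renaming (Carrier to Vertex) public
  field
    Adj           : Rel Vertex e
    Adj-resp-≈    : ∀ {x x′ y y′} → x ≈ x′ → y ≈ y′ → Adj x y → Adj x′ y′
    Adj-symmetric : ∀ {x y} → Adj x y → Adj y x
    Adj-irrefl    : ∀ {x} → ¬ Adj x x

module _ {v ℓ e} (Γ : SimpleGraph v ℓ e) where
  open SimpleGraph Γ
  private module V = Setoid vertices

  PreservesAdj : Inverse vertices vertices → Set (v ⊔ e)
  PreservesAdj σ = ∀ x y → Adj x y ⇔ Adj (Inverse.to σ x) (Inverse.to σ y)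

  preservesAdj-isSubgroup : IsSubgroup (Sym vertices) PreservesAdj
  preservesAdj-isSubgroup = record
    { ∙-closed  = λ {σ} {τ} p q x y →
        Composition.equivalence (q x y) (p (Inverse.to τ x) (Inverse.to τ y))
    ; ε-closed  = λ _ _ → Identity.equivalence _
    ; ⁻¹-closed = λ {σ} p x y →
        let x≈ = Inverse.inverseˡ σ V.refl
            y≈ = Inverse.inverseˡ σ V.refl
            e  = p (Inverse.from σ x) (Inverse.from σ y)
        in mk⇔ (λ xy → Equivalence.from e (Adj-resp-≈ (V.sym x≈) (V.sym y≈) xy))
               (λ xy → Adj-resp-≈ x≈ y≈ (Equivalence.to e xy))
    }

  AutGraph : Group (v ⊔ ℓ ⊔ e) (v ⊔ ℓ)
  AutGraph = subgroup (Sym vertices) preservesAdj-isSubgroup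

-- Equality of scalars is propositional; this loses nothing for finite
-- fields, whose underlying sets have the form Fin q.
record Field c : Set (lsuc c) where
  infixl 7 _*_
  infixl 6 _+_
  infix  8 -_
  field
    Carrier           : Set c
    _+_ _*_           : Carrier → Carrier → Carrier
    -_                : Carrier → Carrier
    0# 1#             : Carrier
    isCommutativeRing : IsCommutativeRing _≡_ _+_ _*_ -_ 0# 1#
    0≢1               : 0# ≢ 1#
    ≢0⇒invertible     : ∀ {x} → x ≢ 0# → Invertible _≡_ 1# _*_ x

  commutativeRing : CommutativeRing c c
  commutativeRing = record { isCommutativeRing = isCommutativeRing }

  open CommutativeRing commutativeRing public
    using ( ring; semiring; rawRing; +-assoc; +-comm; +-identityˡ; +-identityʳ; -‿inverseʳ
          ; *-assoc; *-comm; *-identityˡ; *-identityʳ; zeroˡ; zeroʳ; distribˡ )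

module _ (F : Field c) where
  open Field F
  open RingMorphisms rawRing rawRing using (IsRingHomomorphism)

  module _ where
    open ≡-Reasoning

    *-≢0 : ∀ {x y} → x ≢ 0# → y ≢ 0# → x * y ≢ 0#
    *-≢0 {x} {y} x≢0 y≢0 xy≡0 with ≢0⇒invertible x≢0
    ... | x⁻¹ , x⁻¹x≡1 , _ = y≢0 (begin
      y              ≡⟨ *-identityˡ y ⟨
      1# * y         ≡⟨ cong (_* y) x⁻¹x≡1 ⟨
      (x⁻¹ * x) * y  ≡⟨ *-assoc x⁻¹ x y ⟩
      x⁻¹ * (x * y)  ≡⟨ cong (x⁻¹ *_) xy≡0 ⟩
      x⁻¹ * 0#       ≡⟨ zeroʳ x⁻¹ ⟩
      0#             ∎)

    invertible⇒≢0 : ∀ {x y} → x * y ≡ 1# → y ≢ 0#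
    invertible⇒≢0 {x} xy≡1 y≡0 =
      0≢1 (trans (sym (zeroʳ x)) (trans (cong (x *_) (sym y≡0)) xy≡1))

    inverse-unique : ∀ {x y z} → y * x ≡ 1# → x * z ≡ 1# → y ≡ z
    inverse-unique {x} {y} {z} yx≡1 xz≡1 = begin
      y            ≡⟨ *-identityʳ y ⟨
      y * 1#       ≡⟨ cong (y *_) xz≡1 ⟨
      y * (x * z)  ≡⟨ *-assoc y x z ⟨
      (y * x) * z  ≡⟨ cong (_* z) yx≡1 ⟩
      1# * z       ≡⟨ *-identityˡ z ⟩
      z            ∎

  F* : Group c c
  F* = record
    { Carrier = Σ Carrier (_≢ 0#)
    ; _≈_     = λ x y → proj₁ x ≡ proj₁ y
    ; _∙_     = λ (x , x≢0) (y , y≢0) → x * y , *-≢0 x≢0 y≢0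
    ; ε       = 1# , 0≢1 ∘ sym
    ; _⁻¹     = λ (x , x≢0) → let (y , _ , xy≡1) = ≢0⇒invertible x≢0 in y , invertible⇒≢0 xy≡1
    ; isGroup = record
      { isMonoid = record
        { isSemigroup = record
          { isMagma = record
            { isEquivalence = record { refl = refl ; sym = sym ; trans = trans }
            ; ∙-cong        = cong₂ _*_
            }
          ; assoc = λ (x , _) (y , _) (z , _) → *-assoc x y z
          }
        ; identity = (λ (x , _) → *-identityˡ x) , (λ (x , _) → *-identityʳ x)
        }
      ; inverse = (λ (_ , x≢0) → proj₁ (proj₂ (≢0⇒invertible x≢0)))
                , (λ (_ , x≢0) → proj₂ (proj₂ (≢0⇒invertible x≢0)))
      ; ⁻¹-cong = λ { {_ , x≢0} {_ , y≢0} refl →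
          inverse-unique (proj₁ (proj₂ (≢0⇒invertible x≢0))) (proj₂ (proj₂ (≢0⇒invertible y≢0))) }
      }
    }

  IsFieldAut : Inverse (≡.setoid Carrier) (≡.setoid Carrier) → Set c
  IsFieldAut π = IsRingHomomorphism (Inverse.to π)

  isFieldAut-isSubgroup : IsSubgroup (Sym (≡.setoid Carrier)) IsFieldAut
  isFieldAut-isSubgroup = record
    { ∙-closed  = λ p q → RingComposition.isRingHomomorphism trans q p
    ; ε-closed  = RingIdentity.isRingHomomorphism rawRing refl
    ; ⁻¹-closed = λ {π} p → let module p = IsRingHomomorphism p in record
        { isSemiringHomomorphism = record
          { isNearSemiringHomomorphism = record
            { +-isMonoidHomomorphism = record
              { isMagmaHomomorphism = record
                { isRelHomomorphism = record { cong = cong (Inverse.from π) }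
                ; homo              = λ x y → Inverse.inverseʳ π (sym (trans (p.+-homo _ _)
                    (cong₂ _+_ (Inverse.inverseˡ π refl) (Inverse.inverseˡ π refl))))
                }
              ; ε-homo = Inverse.inverseʳ π (sym p.0#-homo)
              }
            ; *-homo = λ x y → Inverse.inverseʳ π (sym (trans (p.*-homo _ _)
                (cong₂ _*_ (Inverse.inverseˡ π refl) (Inverse.inverseˡ π refl))))
            }
          ; 1#-homo = Inverse.inverseʳ π (sym p.1#-homo)
          }
        ; -‿homo = λ x → Inverse.inverseʳ π (sym (trans (p.-‿homo _)
            (cong -_ (Inverse.inverseˡ π refl))))
        }
    }

  AutField : Group c c
  AutField = subgroup (Sym (≡.setoid Carrier)) isFieldAut-isSubgroup

  F*^ : ℕ → Group c c
  F*^ ν = Pointwise.group (Fin ν) F*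

  φ : ∀ ν → Action AutField (F*^ ν)
  φ ν = record
    { _▷_     = λ π k i → Inverse.to (proj₁ π) (proj₁ (k i)) , to-≢0 π (proj₂ (k i))
    ; ▷-cong  = λ {π} p q i → trans (cong (Inverse.to (proj₁ π)) (q i)) (p _)
    ; ▷-homo  = λ π k k′ i → IsRingHomomorphism.*-homo (proj₂ π) (proj₁ (k i)) (proj₁ (k′ i))
    ; ▷-comp  = λ _ _ _ _ → refl
    ; ▷-ident = λ _ _ → refl
    }
    where
    to-≢0 : ∀ (π : Group.Carrier AutField) {x} → x ≢ 0# → Inverse.to (proj₁ π) x ≢ 0#
    to-≢0 (π , p) x≢0 πx≡0 = x≢0
      (trans (sym (Inverse.inverseʳ π refl))
        (Inverse.inverseʳ π (trans πx≡0 (sym (IsRingHomomorphism.0#-homo p)))))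

  open Sum semiring using (sum; sum-cong-≗; sum-replicate-zero; *-distribˡ-sum)
  open RingProperties ring using (-‿distribˡ-*; -‿involutive; -0#≈0#; -‿+-comm)

  Row : ℕ → Set c
  Row n = Vector Carrier n

  Matrix : ℕ → ℕ → Set c
  Matrix m n = Vector (Row n) m

  infixr 8 _·ᵣ_
  infixl 8 _ᵣ*_ _*ₘ_
  infixl 7 _∙ᵣ_

  _·ᵣ_ : ∀ {n} → Carrier → Row n → Row n
  (k ·ᵣ α) i = k * α i

  -- α ∙ᵣ β is α ᵗβ
  _∙ᵣ_ : ∀ {n} → Row n → Row n → Carrier
  α ∙ᵣ β = sum (λ i → α i * β i)

  _ᵣ*_ : ∀ {m n} → Row m → Matrix m n → Row n
  (α ᵣ* A) j = α ∙ᵣ (λ i → A i j)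

  _*ₘ_ : ∀ {l m n} → Matrix l m → Matrix m n → Matrix l n
  (A *ₘ B) i = A i ᵣ* B

  unit : ∀ {n} → Fin n → Row n
  unit i j = if does (i ≟ j) then 1# else 0#

  unit-diagonal : ∀ {n} (i : Fin n) → unit i i ≡ 1#
  unit-diagonal i with i ≟ i
  ... | yes _  = refl
  ... | no i≢i = ⊥-elim (i≢i refl)

  NonZeroRow : ∀ {n} → Row n → Set c
  NonZeroRow α = ¬ (∀ i → α i ≡ 0#)

  infix 4 _∈⟨_⟩ _≈ₛ_

  _∈⟨_⟩ : ∀ {n} → Row n → Row n → Set c
  v ∈⟨ α ⟩ = ∃ λ k → ∀ i → v i ≡ (k ·ᵣ α) i

  -- α and β span the same subspace
  _≈ₛ_ : ∀ {n} → Rel (Row n) c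
  α ≈ₛ β = ∀ v → v ∈⟨ α ⟩ ⇔ v ∈⟨ β ⟩

  -- The one-dimensional subspace [α] is represented by its generator α, and
  -- equality is equality of the subspaces.
  Lines : ℕ → Setoid c c
  Lines n = record
    { Carrier       = Σ (Row n) NonZeroRow
    ; _≈_           = λ α β → proj₁ α ≈ₛ proj₁ β
    ; isEquivalence = record
      { refl  = λ _ → Identity.equivalence _
      ; sym   = λ p v → Symmetry.equivalence (p v)
      ; trans = λ p q v → Composition.equivalence (p v) (q v)
      }
    }

  ≈ₛ⇒∈ : ∀ {n} {α β : Row n} → α ≈ₛ β → α ∈⟨ β ⟩
  ≈ₛ⇒∈ {α = α} α≈β = Equivalence.to (α≈β α) (1# , λ i → sym (*-identityˡ (α i)))

  -- Index combine i j (i < ν, j < 2) is the j-th coordinate of the i-th 2 × 2 block.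
  K : ∀ ν → Matrix (ν ℕ.* 2) (ν ℕ.* 2)
  K ν r s =
    if does (proj₁ (remQuot {ν} 2 r) ≟ proj₁ (remQuot {ν} 2 s))
    then J (proj₂ (remQuot {ν} 2 r)) (proj₂ (remQuot {ν} 2 s))
    else 0#
    where
    J : Matrix 2 2
    J zero       zero       = 0#
    J zero       (suc zero) = 1#
    J (suc zero) zero       = - 1#
    J (suc zero) (suc zero) = 0#

  form : ∀ ν → Row (ν ℕ.* 2) → Row (ν ℕ.* 2) → Carrier
  form ν α β = (α ᵣ* K ν) ∙ᵣ β

  private
    shift : ∀ {n} → Row (suc (suc n)) → Row n
    shift α i = α (suc (suc i))

    sum-zero : ∀ {n} (f : Row n) → (∀ i → f i ≡ 0#) → sum f ≡ 0#
    sum-zero {n} f f≡0 = trans (sum-cong-≗ f≡0) (sum-replicate-zero n)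

  open ≡-Reasoning

  form-suc : ∀ ν (α β : Row (suc ν ℕ.* 2)) →
    form (suc ν) α β ≡
    (- α (suc zero)) * β zero + (α zero * β (suc zero) + form ν (shift α) (shift β))
  form-suc ν α β = cong₂ _+_ (cong (_* β zero) c₀)
    (cong₂ _+_ (cong (_* β (suc zero)) c₁)
      (sum-cong-≗ (λ j → cong (_* β (suc (suc j))) (c₂ j))))
    where
    α₀ = α zero
    α₁ = α (suc zero)

    rest : sum (λ i → shift α i * 0#) ≡ 0#
    rest = sum-zero _ (λ i → zeroʳ (shift α i))

    c₀ : α₀ * 0# + (α₁ * - 1# + sum (λ i → shift α i * 0#)) ≡ - α₁
    c₀ = begin
      α₀ * 0# + (α₁ * - 1# + sum (λ i → shift α i * 0#))
        ≡⟨ cong₂ _+_ (zeroʳ α₀) (cong (α₁ * - 1# +_) rest) ⟩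
      0# + (α₁ * - 1# + 0#)  ≡⟨ +-identityˡ _ ⟩
      α₁ * - 1# + 0#         ≡⟨ +-identityʳ _ ⟩
      α₁ * - 1#              ≡⟨ *-comm α₁ (- 1#) ⟩
      - 1# * α₁              ≡⟨ -‿distribˡ-* 1# α₁ ⟨
      - (1# * α₁)            ≡⟨ cong -_ (*-identityˡ α₁) ⟩
      - α₁                   ∎

    c₁ : α₀ * 1# + (α₁ * 0# + sum (λ i → shift α i * 0#)) ≡ α₀
    c₁ = begin
      α₀ * 1# + (α₁ * 0# + sum (λ i → shift α i * 0#))
        ≡⟨ cong₂ _+_ (*-identityʳ α₀) (cong₂ _+_ (zeroʳ α₁) rest) ⟩
      α₀ + (0# + 0#)  ≡⟨ cong (α₀ +_) (+-identityˡ 0#) ⟩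
      α₀ + 0#         ≡⟨ +-identityʳ α₀ ⟩
      α₀              ∎

    c₂ : ∀ j → α₀ * 0# + (α₁ * 0# + (shift α ᵣ* K ν) j) ≡ (shift α ᵣ* K ν) j
    c₂ j = trans (cong₂ _+_ (zeroʳ α₀) (cong (_+ (shift α ᵣ* K ν) j) (zeroʳ α₁)))
      (trans (+-identityˡ _) (+-identityˡ _))

  form-alternating : ∀ ν α → form ν α α ≡ 0#
  form-alternating zero    α = refl
  form-alternating (suc ν) α = begin
    form (suc ν) α α                            ≡⟨ form-suc ν α α ⟩
    - α₁ * α₀ + (α₀ * α₁ + form ν _ _)          ≡⟨ +-assoc _ _ _ ⟨
    (- α₁ * α₀ + α₀ * α₁) + form ν _ _          ≡⟨ cong₂ _+_ cancel (form-alternating ν (shift α)) ⟩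
    0# + 0#                                     ≡⟨ +-identityˡ 0# ⟩
    0#                                          ∎
    where
    α₀ = α zero
    α₁ = α (suc zero)
    cancel : - α₁ * α₀ + α₀ * α₁ ≡ 0#
    cancel = begin
      - α₁ * α₀ + α₀ * α₁      ≡⟨ +-comm _ _ ⟩
      α₀ * α₁ + - α₁ * α₀      ≡⟨ cong₂ _+_ (*-comm α₀ α₁) (sym (-‿distribˡ-* α₁ α₀)) ⟩
      α₁ * α₀ + - (α₁ * α₀)    ≡⟨ -‿inverseʳ _ ⟩
      0#                       ∎

  form-antisym : ∀ ν α β → form ν β α ≡ - form ν α β
  form-antisym zero    α β = sym -0#≈0#
  form-antisym (suc ν) α β = begin
    form (suc ν) β α                                    ≡⟨ form-suc ν β α ⟩
    - β₁ * α₀ + (β₀ * α₁ + form ν _ _)                  ≡⟨ +-assoc _ _ _ ⟨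
    (- β₁ * α₀ + β₀ * α₁) + form ν _ _
      ≡⟨ cong₂ _+_ swap (form-antisym ν (shift α) (shift β)) ⟩
    - (- α₁ * β₀ + α₀ * β₁) + - form ν _ _              ≡⟨ -‿+-comm _ _ ⟩
    - ((- α₁ * β₀ + α₀ * β₁) + form ν _ _)              ≡⟨ cong -_ (+-assoc _ _ _) ⟩
    - (- α₁ * β₀ + (α₀ * β₁ + form ν _ _))              ≡⟨ cong -_ (form-suc ν α β) ⟨
    - form (suc ν) α β                                  ∎
    where
    α₀ = α zero
    α₁ = α (suc zero)
    β₀ = β zero
    β₁ = β (suc zero)
    swap : - β₁ * α₀ + β₀ * α₁ ≡ - (- α₁ * β₀ + α₀ * β₁)
    swap = begin
      - β₁ * α₀ + β₀ * α₁          ≡⟨ +-comm _ _ ⟩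
      β₀ * α₁ + - β₁ * α₀          ≡⟨ cong₂ _+_ (*-comm β₀ α₁) (sym (-‿distribˡ-* β₁ α₀)) ⟩
      α₁ * β₀ + - (β₁ * α₀)        ≡⟨ cong₂ _+_ (-‿involutive _) (cong -_ (*-comm α₀ β₁)) ⟨
      - (- (α₁ * β₀)) + - (α₀ * β₁)  ≡⟨ -‿+-comm _ _ ⟩
      - (- (α₁ * β₀) + α₀ * β₁)    ≡⟨ cong (λ t → - (t + α₀ * β₁)) (-‿distribˡ-* α₁ β₀) ⟩
      - (- α₁ * β₀ + α₀ * β₁)      ∎

  form-∈ʳ : ∀ ν {α β β′} → β ∈⟨ β′ ⟩ → form ν α β′ ≡ 0# → form ν α β ≡ 0#
  form-∈ʳ ν {α} {β} {β′} (k , β≡kβ′) αβ′≡0 = begin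
    sum (λ i → γ i * β i)          ≡⟨ sum-cong-≗ step ⟩
    sum (λ i → k * (γ i * β′ i))   ≡⟨ *-distribˡ-sum k (λ i → γ i * β′ i) ⟨
    k * form ν α β′                ≡⟨ cong (k *_) αβ′≡0 ⟩
    k * 0#                         ≡⟨ zeroʳ k ⟩
    0#                             ∎
    where
    γ = α ᵣ* K ν
    step : ∀ i → γ i * β i ≡ k * (γ i * β′ i)
    step i = begin
      γ i * β i           ≡⟨ cong (γ i *_) (β≡kβ′ i) ⟩
      γ i * (k * β′ i)    ≡⟨ *-assoc (γ i) k (β′ i) ⟨
      (γ i * k) * β′ i    ≡⟨ cong (_* β′ i) (*-comm (γ i) k) ⟩
      (k * γ i) * β′ i    ≡⟨ *-assoc k (γ i) (β′ i) ⟩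
      k * (γ i * β′ i)    ∎

  form-sym : ∀ ν α β → form ν α β ≡ 0# → form ν β α ≡ 0#
  form-sym ν α β αβ≡0 = trans (form-antisym ν α β) (trans (cong -_ αβ≡0) -0#≈0#)

  form-∈ˡ : ∀ ν {α α′ β} → α ∈⟨ α′ ⟩ → form ν α′ β ≡ 0# → form ν α β ≡ 0#
  form-∈ˡ ν {α} {α′} {β} α∈α′ α′β≡0 =
    form-sym ν β α (form-∈ʳ ν α∈α′ (form-sym ν α′ β α′β≡0))

  SpGraph : ℕ → SimpleGraph c c c
  SpGraph ν = record
    { vertices      = Lines (ν ℕ.* 2)
    ; Adj           = λ α β → form ν (proj₁ α) (proj₁ β) ≢ 0#
    ; Adj-resp-≈    = λ {α} {α′} {β} {β′} α≈α′ β≈β′ αβ≢0 α′β′≡0 →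
        αβ≢0 (form-∈ˡ ν (≈ₛ⇒∈ α≈α′) (form-∈ʳ ν (≈ₛ⇒∈ β≈β′) α′β′≡0))
    ; Adj-symmetric = λ {α} {β} αβ≢0 βα≡0 → αβ≢0 (form-sym ν (proj₁ β) (proj₁ α) βα≡0)
    ; Adj-irrefl    = λ {α} αα≢0 → αα≢0 (form-alternating ν (proj₁ α))
    }

  Aut-Sp : ℕ → Group c c
  Aut-Sp ν = AutGraph (SpGraph ν)

  act : ∀ ν → Group.Carrier (Aut-Sp ν) →
        SimpleGraph.Vertex (SpGraph ν) → SimpleGraph.Vertex (SpGraph ν)
  act ν σ = Inverse.to (proj₁ σ)

  IsSymplectic : ∀ ν → Matrix (ν ℕ.* 2) (ν ℕ.* 2) → Set c
  IsSymplectic ν T = ∀ i j → (T *ₘ K ν *ₘ transpose T) i j ≡ K ν i j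

  -- The set { σ_T : T symplectic } of automorphisms, where σ_T [α] = [α T].  Matrices
  -- differing by a scalar give the same automorphism, so this is Sp modulo ±I.
  PSp : ∀ ν → Group.Carrier (Aut-Sp ν) → Set c
  PSp ν σ = ∃ λ T → IsSymplectic ν T × (∀ x → proj₁ (act ν σ x) ≈ₛ proj₁ x ᵣ* T)

  -- Coordinates are ordered e₁, f₁, e₂, f₂, …
  e f : ∀ ν → Fin ν → SimpleGraph.Vertex (SpGraph ν)
  e ν i = unit (combine i zero) , λ u≡0 →
    0≢1 (trans (sym (u≡0 (combine i zero))) (unit-diagonal (combine i zero)))
  f ν i = unit (combine i (suc zero)) , λ u≡0 →
    0≢1 (trans (sym (u≡0 (combine i (suc zero)))) (unit-diagonal (combine i (suc zero))))

  FixesBasis : ∀ ν → Group.Carrier (Aut-Sp ν) → Set c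
  FixesBasis ν σ = ∀ i → act ν σ (e ν i) ≈ e ν i × act ν σ (f ν i) ≈ f ν i
    where open SimpleGraph (SpGraph ν) using (_≈_)

  fixesBasis-isSubgroup : ∀ ν → IsSubgroup (Aut-Sp ν) (FixesBasis ν)
  fixesBasis-isSubgroup ν = record
    { ∙-closed  = λ {σ} {τ} p q i →
          L.trans {act ν σ (act ν τ (e ν i))} {act ν σ (e ν i)} {e ν i}
            (Inverse.to-cong (proj₁ σ) (proj₁ (q i))) (proj₁ (p i))
        , L.trans {act ν σ (act ν τ (f ν i))} {act ν σ (f ν i)} {f ν i}
            (Inverse.to-cong (proj₁ σ) (proj₂ (q i))) (proj₂ (p i))
    ; ε-closed  = λ i → L.refl {e ν i} , L.refl {f ν i}
    ; ⁻¹-closed = λ {σ} p i →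
          Inverse.inverseʳ (proj₁ σ) {e ν i} {e ν i} (L.sym {act ν σ (e ν i)} {e ν i} (proj₁ (p i)))
        , Inverse.inverseʳ (proj₁ σ) {f ν i} {f ν i} (L.sym {act ν σ (f ν i)} {f ν i} (proj₂ (p i)))
    }
    where module L = Setoid (Lines (ν ℕ.* 2))

  E : ℕ → Group c c
  E ν = subgroup (Aut-Sp ν) (fixesBasis-isSubgroup ν)

{-# OPTIONS --safe #-}
-- The images A of the basis vectors under an automorphism have the same
-- orthogonality relations as the basis, so rescaling them gives the rows of a
-- symplectic matrix T.  T is invertible because a vector orthogonal to all A
-- would come from one orthogonal to the whole basis; composing with its inverse
-- leaves an automorphism fixing the basis, which is (1).
--
-- An automorphism σ fixing the basis turns each relation x_b = t x_a between two
-- coordinates into a relation x_b = t′ x_a.  So on vectors with first coordinate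
-- 1 it acts coordinatewise, by bijections t ↦ κ_b π_b(t) with π_b(1) = 1.  For
-- ν = 1 any single bijection fixing 0 is possible, giving (2).  For ν > 1, comparing
-- three coordinates shows that all π_b agree and are multiplicative, and
-- orthogonality of e₁ + s f₁ + eᵢ and e₁ + u f₁ + w fᵢ, i.e. s = u + w, shows that
-- they are additive and that κ(eᵢ) κ(fᵢ) = κ(f₁), giving (3).

module Submission where

open import Defs
open import Algebra.Bundles using (Group; CommutativeRing)
open import Algebra.Morphism.Structures using (module GroupMorphisms; module RingMorphisms)
import Algebra.Properties.Group as GroupProperties
import Algebra.Properties.Ring as RingProperties
import Algebra.Properties.Semiring.Sum as SemiringSum
import Algebra.Solver.Ring.NaturalCoefficients.Default as NatSolver
open import Data.Fin.Base using (Fin; zero; suc; combine)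
open import Data.Fin.Permutation using (Permutation; _⟨$⟩ʳ_; lift₀; remove; transpose; lift₀-cong; lift₀-comp; lift₀-remove)
import Data.Fin.Properties as Fin
open import Data.Nat.Base using (ℕ; zero; suc; s≤s; z≤n; _∸_; _<_; _≤_) renaming (_*_ to _ℕ*_)
open import Data.Product.Base using (Σ; ∃; ∃₂; _×_; _,_; proj₁; proj₂)
open import Data.Sum.Base as Sum using (_⊎_; inj₁; inj₂)
open import Function.Base using (_∘_; id; case_of_)
open import Function.Bundles using (_↔_; Inverse; Equivalence; mk⇔; mk↔ₛ′)
open import Function.Construct.Composition using (_↔-∘_)
open import Function.Construct.Symmetry using (↔-sym)
open import Function.Properties.Inverse using (↔⇒↣)
open import Relation.Binary.Definitions using (DecidableEquality)
open import Relation.Binary.PropositionalEquality using (_≡_; _≢_; refl; sym; trans; cong; cong₂; subst; setoid; module ≡-Reasoning)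
open import Relation.Nullary.Decidable using (yes; no; decidable-stable; via-injection)
open import Relation.Nullary.Negation using (¬_; contradiction)

-- Adjacency is a negated equation and a vertex is a row that is not zero, so an automorphism gives
-- orthogonality only up to double negation. The enumeration of the field supplies a decidable
-- equality that removes it. A line has no preferred generator, so the image of a line is known only
-- up to a scalar that varies with the line. Whatever is extracted from an automorphism must
-- therefore be the vanishing of a coordinate or a ratio of two coordinates. Normalising the first
-- coordinate to 1 misses the lines with first coordinate 0. For ν = 1 there is one such line, [f₁];
-- for ν > 1 they are reached through ratios based at another nonzero coordinate. The ν factors of
-- the torus arise by counting: weights with w(eᵢ) w(fᵢ) independent of i have ν + 1 parameters, and
-- one is lost because scalar matrices act trivially.

module RingIdentities {c} (F : Field c) where
  open Field F using (_+_; _*_)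
  open NatSolver (CommutativeRing.commutativeSemiring (Field.commutativeRing F))

  x*yz≡y*xz : ∀ x y z → x * (y * z) ≡ y * (x * z)
  x*yz≡y*xz = solve 3 (λ x y z → x :* (y :* z) := y :* (x :* z)) refl

  [xy][zw]≡[xz][yw] : ∀ x y z w → (x * y) * (z * w) ≡ (x * z) * (y * w)
  [xy][zw]≡[xz][yw] = solve 4 (λ x y z w → (x :* y) :* (z :* w) := (x :* z) :* (y :* w)) refl

  [xy][z[wv]]≡[xw][y[zv]] : ∀ x y z w v → (x * y) * (z * (w * v)) ≡ (x * w) * (y * (z * v))
  [xy][z[wv]]≡[xw][y[zv]] = solve 5
    (λ x y z w v → (x :* y) :* (z :* (w :* v)) := (x :* w) :* (y :* (z :* v))) refl

  [x[yz]]w≡y[[xz]w] : ∀ x y z w → (x * (y * z)) * w ≡ y * ((x * z) * w)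
  [x[yz]]w≡y[[xz]w] = solve 4 (λ x y z w → (x :* (y :* z)) :* w := y :* ((x :* z) :* w)) refl

  x[[yz]w]≡[zx][yw] : ∀ x y z w → x * ((y * z) * w) ≡ (z * x) * (y * w)
  x[[yz]w]≡[zx][yw] = solve 4 (λ x y z w → x :* ((y :* z) :* w) := (z :* x) :* (y :* w)) refl

  x[y[zw]]≡[[xz]w]y : ∀ x y z w → x * (y * (z * w)) ≡ ((x * z) * w) * y
  x[y[zw]]≡[[xz]w]y = solve 4 (λ x y z w → x :* (y :* (z :* w)) := ((x :* z) :* w) :* y) refl

  [xy+z]w≡y[xw]+zw : ∀ x y z w → (x * y + z) * w ≡ y * (x * w) + z * w
  [xy+z]w≡y[xw]+zw = solve 4 (λ x y z w → (x :* y :+ z) :* w := y :* (x :* w) :+ z :* w) refl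

-- Coordinates grouped into hyperbolic pairs.

eIndex fIndex : ∀ {ν} → Fin ν → Fin (ν ℕ* 2)
eIndex {ν} i = combine {ν} {2} i zero
fIndex {ν} i = combine {ν} {2} i (suc zero)

-- The partner of a coordinate in its hyperbolic pair: row `a` of `K` has its only nonzero entry in
-- column `dual ν a`.
dual : ∀ ν → Fin (ν ℕ* 2) → Fin (ν ℕ* 2)
dual (suc ν) zero          = suc zero
dual (suc ν) (suc zero)    = zero
dual (suc ν) (suc (suc a)) = suc (suc (dual ν a))

dual-involutive : ∀ ν a → dual ν (dual ν a) ≡ a
dual-involutive (suc ν) zero          = refl
dual-involutive (suc ν) (suc zero)    = refl
dual-involutive (suc ν) (suc (suc a)) = cong (λ x → suc (suc x)) (dual-involutive ν a)

dual-e : ∀ ν (i : Fin ν) → dual ν (eIndex i) ≡ fIndex i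
dual-e (suc ν) zero    = refl
dual-e (suc ν) (suc i) = cong (λ x → suc (suc x)) (dual-e ν i)

dual-f : ∀ ν (i : Fin ν) → dual ν (fIndex i) ≡ eIndex i
dual-f ν i = trans (cong (dual ν) (sym (dual-e ν i))) (dual-involutive ν _)

coordinate-elim : ∀ {p} ν (P : Fin (ν ℕ* 2) → Set p) →
  (∀ (i : Fin ν) → P (eIndex i)) → (∀ (i : Fin ν) → P (fIndex i)) → ∀ a → P a
coordinate-elim (suc ν) P Pe Pf zero          = Pe zero
coordinate-elim (suc ν) P Pe Pf (suc zero)    = Pf zero
coordinate-elim (suc ν) P Pe Pf (suc (suc a)) =
  coordinate-elim ν (λ a → P (suc (suc a))) (Pe ∘ suc) (Pf ∘ suc) a

interleave : ∀ {a} {A : Set a} ν → (Fin ν → A) → (Fin ν → A) → Fin (ν ℕ* 2) → A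
interleave (suc ν) x y zero          = x zero
interleave (suc ν) x y (suc zero)    = y zero
interleave (suc ν) x y (suc (suc a)) = interleave ν (x ∘ suc) (y ∘ suc) a

interleave-e : ∀ {a} {A : Set a} ν (x y : Fin ν → A) i → interleave ν x y (eIndex i) ≡ x i
interleave-e (suc ν) x y zero    = refl
interleave-e (suc ν) x y (suc i) = interleave-e ν (x ∘ suc) (y ∘ suc) i

interleave-f : ∀ {a} {A : Set a} ν (x y : Fin ν → A) i → interleave ν x y (fIndex i) ≡ y i
interleave-f (suc ν) x y zero    = refl
interleave-f (suc ν) x y (suc i) = interleave-f ν (x ∘ suc) (y ∘ suc) i

module SymplecticSpace {c} (F : Field c) (_≟_ : DecidableEquality (Field.Carrier F)) where
  open Field F
  open RingIdentities F
  open RingProperties ring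
    using (-‿distribˡ-*; -‿distribʳ-*; -‿involutive; -0#≈0#; +-cancelʳ; +-cancelˡ)
  open SemiringSum semiring using (sum; sum-cong-≗; sum-replicate-zero; *-distribˡ-sum; *-distribʳ-sum; ∑-comm; ∑-distrib-+)
  open CommutativeRing commutativeRing using (distribʳ)
  open RingMorphisms rawRing rawRing using (module IsRingHomomorphism)
  open ≡-Reasoning

  -- Field arithmetic and finite sums.

  inv : ∀ {x} → x ≢ 0# → Carrier
  inv x≢0 = proj₁ (≢0⇒invertible x≢0)

  invˡ : ∀ {x} (x≢0 : x ≢ 0#) → inv x≢0 * x ≡ 1#
  invˡ x≢0 = proj₁ (proj₂ (≢0⇒invertible x≢0))

  invʳ : ∀ {x} (x≢0 : x ≢ 0#) → x * inv x≢0 ≡ 1#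
  invʳ x≢0 = proj₂ (proj₂ (≢0⇒invertible x≢0))

  1≢0 : 1# ≢ 0#
  1≢0 = 0≢1 ∘ sym

  inv≢0 : ∀ {x} (x≢0 : x ≢ 0#) → inv x≢0 ≢ 0#
  inv≢0 x≢0 = invertible⇒≢0 F (invʳ x≢0)

  inv-cancelˡ : ∀ {x} (x≢0 : x ≢ 0#) y → inv x≢0 * (x * y) ≡ y
  inv-cancelˡ x≢0 y = trans (sym (*-assoc _ _ _)) (trans (cong (_* y) (invˡ x≢0)) (*-identityˡ y))

  inv-cancelʳ : ∀ {x} (x≢0 : x ≢ 0#) y → x * (inv x≢0 * y) ≡ y
  inv-cancelʳ x≢0 y = trans (sym (*-assoc _ _ _)) (trans (cong (_* y) (invʳ x≢0)) (*-identityˡ y))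

  *-cancelˡ : ∀ {x y z} → x ≢ 0# → x * y ≡ x * z → y ≡ z
  *-cancelˡ x≢0 xy≡xz =
    trans (sym (inv-cancelˡ x≢0 _)) (trans (cong (inv x≢0 *_) xy≡xz) (inv-cancelˡ x≢0 _))

  *-cancelʳ : ∀ {x y z} → x ≢ 0# → y * x ≡ z * x → y ≡ z
  *-cancelʳ x≢0 yx≡zx = *-cancelˡ x≢0 (trans (*-comm _ _) (trans yx≡zx (*-comm _ _)))

  x*y≡0⇒y≡0 : ∀ {x y} → x ≢ 0# → x * y ≡ 0# → y ≡ 0#
  x*y≡0⇒y≡0 x≢0 xy≡0 = *-cancelˡ x≢0 (trans xy≡0 (sym (zeroʳ _)))

  -1*x : ∀ x → (- 1#) * x ≡ - x
  -1*x x = trans (sym (-‿distribˡ-* 1# x)) (cong -_ (*-identityˡ x))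

  x≡y⇒x-y≡0 : ∀ {x y} → x ≡ y → x + - y ≡ 0#
  x≡y⇒x-y≡0 refl = -‿inverseʳ _

  x-y≡0⇒x≡y : ∀ {x y} → x + - y ≡ 0# → x ≡ y
  x-y≡0⇒x≡y {x} {y} x-y≡0 = +-cancelʳ (- y) x y (trans x-y≡0 (sym (-‿inverseʳ y)))

  private
    variable
      n : ℕ
      α β γ : Row F n

  ∑-zero : ∀ {n} (g : Row F n) → (∀ i → g i ≡ 0#) → sum g ≡ 0#
  ∑-zero {n} g g≡0 = trans (sum-cong-≗ g≡0) (sum-replicate-zero n)

  unit-off : ∀ {n} {i j : Fin n} → i ≢ j → unit F i j ≡ 0#
  unit-off {i = i} {j} i≢j with i Fin.≟ j
  ... | yes i≡j = contradiction i≡j i≢j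
  ... | no _    = refl

  ∑-unitˡ : ∀ {n} (i : Fin n) (g : Row F n) → sum (λ j → unit F i j * g j) ≡ g i
  ∑-unitˡ zero g = trans
    (cong₂ _+_ (*-identityˡ _) (∑-zero _ (λ j → zeroˡ (g (suc j))))) (+-identityʳ _)
  ∑-unitˡ (suc i) g = trans
    (cong₂ _+_ (zeroˡ (g zero)) (∑-unitˡ i (g ∘ suc))) (+-identityˡ _)

  ∑-unitʳ : ∀ {n} (i : Fin n) (g : Row F n) → sum (λ j → g j * unit F i j) ≡ g i
  ∑-unitʳ i g = trans (sum-cong-≗ (λ j → *-comm (g j) (unit F i j))) (∑-unitˡ i g)

  ∑-supported₂ : ∀ {n} {a b : Fin n} → a ≢ b → (g h : Row F n) →
    (∀ {x} → x ≢ a → x ≢ b → g x ≡ 0#) → sum (λ x → g x * h x) ≡ g a * h a + g b * h b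
  ∑-supported₂ {a = a} {b} a≢b g h g≡0 = begin
    sum (λ x → g x * h x)
      ≡⟨ sum-cong-≗ (λ x → split x) ⟩
    sum (λ x → unit F a x * (g a * h a) + unit F b x * (g b * h b))
      ≡⟨ ∑-distrib-+ (λ x → unit F a x * (g a * h a)) (λ x → unit F b x * (g b * h b)) ⟩
    sum (λ x → unit F a x * (g a * h a)) + sum (λ x → unit F b x * (g b * h b))
      ≡⟨ cong₂ _+_ (∑-unitˡ a (λ _ → g a * h a)) (∑-unitˡ b (λ _ → g b * h b)) ⟩
    g a * h a + g b * h b ∎
    where
    split : ∀ x → g x * h x ≡ unit F a x * (g a * h a) + unit F b x * (g b * h b)
    split x with a Fin.≟ x | b Fin.≟ x
    ... | yes refl | yes refl = contradiction refl a≢b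
    ... | yes refl | no _     = sym (trans (cong₂ _+_ (*-identityˡ _) (zeroˡ _)) (+-identityʳ _))
    ... | no _     | yes refl = sym (trans (cong₂ _+_ (zeroˡ _) (*-identityˡ _)) (+-identityˡ _))
    ... | no a≢x   | no b≢x   = begin
      g x * h x  ≡⟨ cong (_* h x) (g≡0 (a≢x ∘ sym) (b≢x ∘ sym)) ⟩
      0# * h x   ≡⟨ zeroˡ _ ⟩
      0#         ≡⟨ +-identityˡ _ ⟨
      0# + 0#    ≡⟨ cong₂ _+_ (zeroˡ _) (zeroˡ _) ⟨
      0# * (g a * h a) + 0# * (g b * h b) ∎

  ᵣ*-∙ᵣ : ∀ {m n} (α : Row F m) (A : Matrix F m n) (v : Row F n) →
    sum (λ j → sum (λ i → α i * A i j) * v j) ≡ sum (λ i → α i * sum (λ j → A i j * v j))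
  ᵣ*-∙ᵣ α A v = begin
    sum (λ j → sum (λ i → α i * A i j) * v j)
      ≡⟨ sum-cong-≗ (λ j → *-distribʳ-sum (v j) (λ i → α i * A i j)) ⟩
    sum (λ j → sum (λ i → α i * A i j * v j))
      ≡⟨ ∑-comm (λ j i → α i * A i j * v j) ⟩
    sum (λ i → sum (λ j → α i * A i j * v j))
      ≡⟨ sum-cong-≗ (λ i → trans (sum-cong-≗ (λ j → *-assoc (α i) (A i j) (v j)))
           (sym (*-distribˡ-sum (α i) (λ j → A i j * v j)))) ⟩
    sum (λ i → α i * sum (λ j → A i j * v j)) ∎

  -- Treating a row as a vertex and reaching a contradiction only refutes that it is nonzero;
  -- decidable equality then recovers the zeros one coordinate at a time.
  row-≡0-stable : ∀ {n} {α : Row F n} → ¬ ¬ (∀ i → α i ≡ 0#) → ∀ i → α i ≡ 0#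
  row-≡0-stable {α = α} ¬¬0 i = decidable-stable (α i ≟ 0#) (λ αi≢0 → ¬¬0 (λ 0s → αi≢0 (0s i)))

  pivot : ∀ {n} {α : Row F n} → NonZeroRow F α → ∃ λ i → α i ≢ 0#
  pivot {n} {α} = Fin.¬∀⟶∃¬ n (λ i → α i ≡ 0#) (λ i → α i ≟ 0#)

  -- Equality of lines.

  infix 4 _∈_ _≈_

  _∈_ : Row F n → Row F n → Set c
  _∈_ = _∈⟨_⟩ F

  _≈_ : Row F n → Row F n → Set c
  _≈_ = _≈ₛ_ F

  ≈-refl : α ≈ α
  ≈-refl v = mk⇔ id id

  ≈-sym : α ≈ β → β ≈ α
  ≈-sym p v = mk⇔ (Equivalence.from (p v)) (Equivalence.to (p v))

  ≈-trans : α ≈ β → β ≈ γ → α ≈ γ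
  ≈-trans p q v = mk⇔ (Equivalence.to (q v) ∘ Equivalence.to (p v)) (Equivalence.from (p v) ∘ Equivalence.from (q v))

  ≈⇒∈ : α ≈ β → α ∈ β
  ≈⇒∈ = ≈ₛ⇒∈ F

  ∈-trans : α ∈ β → β ∈ γ → α ∈ γ
  ∈-trans (k , α≡kβ) (l , β≡lγ) =
    k * l , λ i → trans (α≡kβ i) (trans (cong (k *_) (β≡lγ i)) (sym (*-assoc _ _ _)))

  ∈⇒≈ : α ∈ β → β ∈ α → α ≈ β
  ∈⇒≈ α∈β β∈α v = mk⇔ (λ v∈α → ∈-trans v∈α α∈β) (λ v∈β → ∈-trans v∈β β∈α)

  proportional : ∀ {k} → k ≢ 0# → (∀ i → α i ≡ k * β i) → α ≈ β
  proportional {β = β} k≢0 α≡kβ = ∈⇒≈ (_ , α≡kβ)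
    (inv k≢0 , λ i → sym (trans (cong (inv k≢0 *_) (α≡kβ i)) (inv-cancelˡ k≢0 (β i))))

  -- Proportionality follows from the 2 × 2 minors through a single pivot column; the factor is
  -- `α i` divided by `β i`.
  cross⇒≈ : ∀ {n} {α β : Row F n} i → α i ≢ 0# → β i ≢ 0# → (∀ j → α j * β i ≡ α i * β j) → α ≈ β
  cross⇒≈ {α = α} {β} i αᵢ≢0 βᵢ≢0 cross = proportional {α = α} {β} (*-≢0 F (inv≢0 βᵢ≢0) αᵢ≢0) (λ j → *-cancelʳ βᵢ≢0 (begin
    α j * β i                          ≡⟨ cross j ⟩
    α i * β j                          ≡⟨ inv-cancelˡ βᵢ≢0 _ ⟨
    inv βᵢ≢0 * (β i * (α i * β j))     ≡⟨ x[y[zw]]≡[[xz]w]y _ _ _ _ ⟩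
    inv βᵢ≢0 * α i * β j * β i         ∎))

  ≗⇒≈ : (∀ i → α i ≡ β i) → α ≈ β
  ≗⇒≈ α≗β = proportional 1≢0 (λ i → trans (α≗β i) (sym (*-identityˡ _)))

  -- A homogeneous equation between coordinates depends on the line and not on its generator. This
  -- makes ratios of coordinates usable as invariants.
  ≈-ratio : ∀ {a b t} → α ≈ β → α b ≡ t * α a → β b ≡ t * β a
  ≈-ratio {a = a} {b} {t} α≈β αb≡tαa with ≈⇒∈ (≈-sym α≈β)
  ... | k , β≡kα = trans (β≡kα b) (trans (cong (k *_) αb≡tαa)
    (trans (x*yz≡y*xz k t _) (cong (t *_) (sym (β≡kα a)))))

  -- The symplectic form in coordinates.

  -- The entry of `K` in row `a` and column `dual ν a`.
  sgn : ∀ ν → Fin (ν ℕ* 2) → Carrier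
  sgn (suc ν) zero          = 1#
  sgn (suc ν) (suc zero)    = - 1#
  sgn (suc ν) (suc (suc a)) = sgn ν a

  sgn² : ∀ ν a → sgn ν a * sgn ν a ≡ 1#
  sgn² (suc ν) zero          = *-identityˡ 1#
  sgn² (suc ν) (suc zero)    = trans (-1*x _) (-‿involutive 1#)
  sgn² (suc ν) (suc (suc a)) = sgn² ν a

  sgn≢0 : ∀ ν a → sgn ν a ≢ 0#
  sgn≢0 ν a = invertible⇒≢0 F (sgn² ν a)

  sgn-dual : ∀ ν a → sgn ν (dual ν a) ≡ - sgn ν a
  sgn-dual (suc ν) zero          = refl
  sgn-dual (suc ν) (suc zero)    = sym (-‿involutive 1#)
  sgn-dual (suc ν) (suc (suc a)) = sgn-dual ν a

  sgn-e : ∀ ν (i : Fin ν) → sgn ν (eIndex i) ≡ 1#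
  sgn-e (suc ν) zero    = refl
  sgn-e (suc ν) (suc i) = sgn-e ν i

  -- Each row of `K` has one nonzero entry, so the double sum collapses to a single signed sum.
  form-dual : ∀ ν α β → form F ν α β ≡ sum (λ a → α a * (sgn ν a * β (dual ν a)))
  form-dual zero    α β = refl
  form-dual (suc ν) α β = begin
    form F (suc ν) α β
      ≡⟨ form-suc F ν α β ⟩
    - α₁ * β₀ + (α₀ * β₁ + form F ν (λ i → α (suc (suc i))) (λ i → β (suc (suc i))))
      ≡⟨ cong₂ _+_ eq₁ (cong₂ _+_ (cong (α₀ *_) (sym (*-identityˡ β₁))) (form-dual ν _ _)) ⟩
    α₁ * (- 1# * β₀) + (α₀ * (1# * β₁) + rest)
      ≡⟨ swap _ _ _ ⟩
    α₀ * (1# * β₁) + (α₁ * (- 1# * β₀) + rest) ∎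
    where
    α₀ = α zero
    α₁ = α (suc zero)
    β₀ = β zero
    β₁ = β (suc zero)
    rest = sum (λ a → α (suc (suc a)) * (sgn ν a * β (suc (suc (dual ν a)))))
    eq₁ : - α₁ * β₀ ≡ α₁ * (- 1# * β₀)
    eq₁ = trans (sym (-‿distribˡ-* α₁ β₀))
      (trans (-‿distribʳ-* α₁ β₀) (cong (α₁ *_) (sym (-1*x β₀))))
    swap : ∀ x y z → x + (y + z) ≡ y + (x + z)
    swap x y z = trans (sym (+-assoc x y z)) (trans (cong (_+ z) (+-comm x y)) (+-assoc y x z))

  module _ (ν : ℕ) where
    form-cong : ∀ {α α′ β β′} → (∀ i → α i ≡ α′ i) → (∀ i → β i ≡ β′ i) →
      form F ν α β ≡ form F ν α′ β′
    form-cong {α} {α′} {β} {β′} α≗α′ β≗β′ = trans (form-dual ν α β) (trans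
      (sum-cong-≗ (λ a → cong₂ _*_ (α≗α′ a) (cong (sgn ν a *_) (β≗β′ (dual ν a)))))
      (sym (form-dual ν α′ β′)))

    form-unitˡ : ∀ a β → form F ν (unit F a) β ≡ sgn ν a * β (dual ν a)
    form-unitˡ a β = trans (form-dual ν (unit F a) β) (∑-unitˡ a _)

    K-form : ∀ a b → form F ν (unit F a) (unit F b) ≡ K F ν a b
    K-form a b = trans (∑-unitʳ b _) (∑-unitˡ a _)

    form-addˡ : ∀ k a α β →
      form F ν (λ i → k * unit F a i + α i) β ≡ k * (sgn ν a * β (dual ν a)) + form F ν α β
    form-addˡ k a α β = begin
      form F ν (λ i → k * unit F a i + α i) β
        ≡⟨ form-dual ν _ β ⟩
      sum (λ i → (k * unit F a i + α i) * (sgn ν i * β (dual ν i)))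
        ≡⟨ sum-cong-≗ (λ i → [xy+z]w≡y[xw]+zw k (unit F a i) (α i) _) ⟩
      sum (λ i → unit F a i * (k * (sgn ν i * β (dual ν i))) + α i * (sgn ν i * β (dual ν i)))
        ≡⟨ ∑-distrib-+ (λ i → unit F a i * (k * (sgn ν i * β (dual ν i)))) _ ⟩
      _ ≡⟨ cong₂ _+_ (∑-unitˡ a (λ i → k * (sgn ν i * β (dual ν i)))) (sym (form-dual ν α β)) ⟩
      k * (sgn ν a * β (dual ν a)) + form F ν α β ∎

    form-∑ˡ : ∀ {m} (α : Row F m) (T : Matrix F m (ν ℕ* 2)) β →
      form F ν (_ᵣ*_ F α T) β ≡ sum (λ a → α a * form F ν (T a) β)
    form-∑ˡ α T β = trans (form-dual ν _ β) (trans (ᵣ*-∙ᵣ α T _)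
      (sum-cong-≗ (λ a → cong (α a *_) (sym (form-dual ν (T a) β)))))

    form-∑ʳ : ∀ {m} (α : Row F m) (T : Matrix F m (ν ℕ* 2)) β →
      form F ν β (_ᵣ*_ F α T) ≡ sum (λ a → α a * form F ν β (T a))
    form-∑ʳ α T β = begin
      sum (λ i → βK i * _ᵣ*_ F α T i)         ≡⟨ sum-cong-≗ (λ i → *-comm (βK i) _) ⟩
      sum (λ i → _ᵣ*_ F α T i * βK i)         ≡⟨ ᵣ*-∙ᵣ α T βK ⟩
      sum (λ a → α a * sum (λ i → T a i * βK i))
        ≡⟨ sum-cong-≗ (λ a → cong (α a *_) (sum-cong-≗ (λ i → *-comm (T a i) (βK i)))) ⟩
      sum (λ a → α a * form F ν β (T a))     ∎
      where
      βK = _ᵣ*_ F β (K F ν)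

    form-·ˡ : ∀ k α β → form F ν (λ i → k * α i) β ≡ k * form F ν α β
    form-·ˡ k α β = begin
      form F ν (λ i → k * α i) β                             ≡⟨ form-dual ν _ β ⟩
      sum (λ a → (k * α a) * (sgn ν a * β (dual ν a)))       ≡⟨ sum-cong-≗ (λ a → *-assoc k (α a) _) ⟩
      sum (λ a → k * (α a * (sgn ν a * β (dual ν a))))       ≡⟨ *-distribˡ-sum k (λ a → α a * (sgn ν a * β (dual ν a))) ⟨
      k * sum (λ a → α a * (sgn ν a * β (dual ν a)))         ≡⟨ cong (k *_) (form-dual ν α β) ⟨
      k * form F ν α β                                       ∎

    form-·ʳ : ∀ k α β → form F ν α (λ i → k * β i) ≡ k * form F ν α β
    form-·ʳ k α β = begin
      form F ν α (λ i → k * β i)      ≡⟨ form-antisym F ν _ α ⟩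
      - form F ν (λ i → k * β i) α    ≡⟨ cong -_ (form-·ˡ k β α) ⟩
      - (k * form F ν β α)            ≡⟨ -‿distribʳ-* k _ ⟩
      k * - form F ν β α              ≡⟨ cong (k *_) (form-antisym F ν β α) ⟨
      k * form F ν α β                ∎

    form-subˡ : ∀ α β γ → form F ν (λ i → α i + - β i) γ ≡ form F ν α γ + - form F ν β γ
    form-subˡ α β γ = begin
      form F ν (λ i → α i + - β i) γ
        ≡⟨ form-dual ν _ γ ⟩
      sum (λ i → (α i + - β i) * x i)
        ≡⟨ sum-cong-≗ (λ i → trans (distribʳ (x i) (α i) (- β i)) (cong (λ t → α i * x i + t * x i) (sym (-1*x (β i))))) ⟩
      sum (λ i → α i * x i + (- 1# * β i) * x i)
        ≡⟨ ∑-distrib-+ (λ i → α i * x i) (λ i → (- 1# * β i) * x i) ⟩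
      sum (λ i → α i * x i) + sum (λ i → (- 1# * β i) * x i)
        ≡⟨ cong₂ _+_ (sym (form-dual ν α γ)) (sym (form-dual ν (λ i → - 1# * β i) γ)) ⟩
      form F ν α γ + form F ν (λ i → - 1# * β i) γ
        ≡⟨ cong (form F ν α γ +_) (trans (form-·ˡ (- 1#) β γ) (-1*x _)) ⟩
      form F ν α γ + - form F ν β γ ∎
      where
      x : Row F (ν ℕ* 2)
      x i = sgn ν i * γ (dual ν i)

    form-unitʳ : ∀ α a → form F ν α (unit F (dual ν a)) ≡ sgn ν a * α a
    form-unitʳ α a = begin
      form F ν α (unit F (dual ν a))                   ≡⟨ form-antisym F ν _ α ⟩
      - form F ν (unit F (dual ν a)) α                 ≡⟨ cong -_ (form-unitˡ (dual ν a) α) ⟩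
      - (sgn ν (dual ν a) * α (dual ν (dual ν a)))     ≡⟨ cong -_ (cong₂ _*_ (sgn-dual ν a) (cong α (dual-involutive ν a))) ⟩
      - (- sgn ν a * α a)                              ≡⟨ -‿distribˡ-* (- sgn ν a) (α a) ⟩
      - - sgn ν a * α a                                ≡⟨ cong (_* α a) (-‿involutive (sgn ν a)) ⟩
      sgn ν a * α a                                    ∎

    private
      V : Set c
      V = SimpleGraph.Vertex (SpGraph F ν)

      N : ℕ
      N = ν ℕ* 2

    unitᵥ : Fin N → V
    unitᵥ a = unit F a , λ u≡0 → 0≢1 (trans (sym (u≡0 a)) (unit-diagonal F a))

    form-nondegenerate : ∀ {α : Row F N} → (∀ a → form F ν α (unit F a) ≡ 0#) → ∀ i → α i ≡ 0#
    form-nondegenerate {α} α⊥ i = x*y≡0⇒y≡0 (sgn≢0 ν (dual ν i)) (begin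
      sgn ν (dual ν i) * α i                    ≡⟨ cong (λ j → sgn ν (dual ν i) * α j) (dual-involutive ν i) ⟨
      sgn ν (dual ν i) * α (dual ν (dual ν i))  ≡⟨ form-unitˡ (dual ν i) α ⟨
      form F ν (unit F (dual ν i)) α            ≡⟨ form-sym F ν α _ (α⊥ (dual ν i)) ⟩
      0#                                        ∎)

    -- Graph automorphisms induced by maps of rows.

    -- The twist `θ` accommodates semilinear maps, which pull a scalar out through a field
    -- automorphism. Additivity is left out because the rank-one maps `stretch p` are in general not
    -- additive.
    Homogeneous : (Carrier → Carrier) → (Row F N → Row F N) → Set c
    Homogeneous θ g = ∀ {α β k} → (∀ i → α i ≡ k * β i) → ∀ i → g α i ≡ θ k * g β i

    -- A homogeneous bijection on vectors that preserves orthogonality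
    -- induces an automorphism of the graph.
    record Collineation : Set c where
      field
        θ θ⁻¹    : Carrier → Carrier
        θ-0      : θ 0# ≡ 0#
        θ⁻¹-0    : θ⁻¹ 0# ≡ 0#
        g g⁻¹    : Row F N → Row F N
        g-homo   : Homogeneous θ g
        g⁻¹-homo : Homogeneous θ⁻¹ g⁻¹
        g-g⁻¹    : ∀ α i → g (g⁻¹ α) i ≡ α i
        g⁻¹-g    : ∀ α i → g⁻¹ (g α) i ≡ α i
        ⊥⇒⊥      : ∀ α β → form F ν α β ≡ 0# → form F ν (g α) (g β) ≡ 0#
        ⊥⇐⊥      : ∀ α β → form F ν (g α) (g β) ≡ 0# → form F ν α β ≡ 0#

      private
        lift : ∀ {θ′} g g′ → θ′ 0# ≡ 0# → Homogeneous θ′ g′ → (∀ α i → g′ (g α) i ≡ α i) → V → V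
        -- A zero row `g α` is `0#` times `α`, so homogeneity of `g′` would make `g′ (g α)`, which
        -- is `α`, zero as well.
        lift g g′ θ′-0 g′-homo g′-g (α , α≢0) = g α , λ gα≡0 → α≢0 (λ i →
          trans (sym (g′-g α i)) (trans (g′-homo {β = α} (λ j → trans (gα≡0 j) (sym (zeroˡ (α j)))) i)
            (trans (cong (_* _) θ′-0) (zeroˡ _))))

        lift-cong : ∀ {θ g} → Homogeneous θ g → ∀ {α β} → α ≈ β → g α ≈ g β
        lift-cong homo α≈β = ∈⇒≈ (_ , homo (proj₂ (≈⇒∈ α≈β))) (_ , homo (proj₂ (≈⇒∈ (≈-sym α≈β))))

      permutation : Inverse (Lines F N) (Lines F N)
      permutation = record
        { to        = lift g g⁻¹ θ⁻¹-0 g⁻¹-homo g⁻¹-g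
        ; from      = lift g⁻¹ g θ-0 g-homo g-g⁻¹
        ; to-cong   = lift-cong g-homo
        ; from-cong = lift-cong g⁻¹-homo
        ; inverse   = (λ {α} y≈ → ≈-trans (lift-cong g-homo y≈) (≗⇒≈ (g-g⁻¹ (proj₁ α))))
                    , (λ {α} y≈ → ≈-trans (lift-cong g⁻¹-homo y≈) (≗⇒≈ (g⁻¹-g (proj₁ α))))
        }

      automorphism : Group.Carrier (Aut-Sp F ν)
      automorphism = permutation , λ α β →
        mk⇔ (λ adj → adj ∘ ⊥⇐⊥ (proj₁ α) (proj₁ β)) (λ adj → adj ∘ ⊥⇒⊥ (proj₁ α) (proj₁ β))

    -- Splitting off a symplectic factor.

    module Automorphism (σ : Group.Carrier (Aut-Sp F ν)) where
      to from : V → V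
      to   = Inverse.to (proj₁ σ)
      from = Inverse.from (proj₁ σ)

      to-cong : ∀ {x y : V} → proj₁ x ≈ proj₁ y → proj₁ (to x) ≈ proj₁ (to y)
      to-cong {x} {y} = Inverse.to-cong (proj₁ σ) {x} {y}

      to-from : ∀ x → proj₁ (to (from x)) ≈ proj₁ x
      to-from x = Inverse.inverseˡ (proj₁ σ) {x} {from x} ≈-refl

      from-to : ∀ x → proj₁ (from (to x)) ≈ proj₁ x
      from-to x = Inverse.inverseʳ (proj₁ σ) {x} {to x} ≈-refl

      -- If the images were adjacent, so would be `x` and `y`; this refutes non-orthogonality, and
      -- `_≟_` turns the refutation into an equation.
      to-⊥ : ∀ x y → form F ν (proj₁ x) (proj₁ y) ≡ 0# → form F ν (proj₁ (to x)) (proj₁ (to y)) ≡ 0#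
      to-⊥ x y x⊥y = decidable-stable (_ ≟ 0#) (λ adj → Equivalence.from (proj₂ σ x y) adj x⊥y)

      from-⊥ : ∀ x y → form F ν (proj₁ (to x)) (proj₁ (to y)) ≡ 0# → form F ν (proj₁ x) (proj₁ y) ≡ 0#
      from-⊥ x y x⊥y = decidable-stable (_ ≟ 0#) (λ adj → Equivalence.to (proj₂ σ x y) adj x⊥y)

    -- Rescaling the images of the basis vectors gives a symplectic basis.
    module _ (σ : Group.Carrier (Aut-Sp F ν)) where
      open Automorphism σ

      private
        A : Matrix F N N
        A a = proj₁ (to (unitᵥ a))

        A-nondegenerate : ∀ (w : Row F N) → (∀ a → form F ν w (A a) ≡ 0#) → ∀ i → w i ≡ 0#
        A-nondegenerate w w⊥A = row-≡0-stable λ w≢0 →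
          let x = from (w , w≢0) in
          proj₂ x (form-nondegenerate (λ a → from-⊥ x (unitᵥ a)
            (form-∈ˡ F ν (≈⇒∈ (to-from (w , w≢0))) (w⊥A a))))

        A-orthogonal : ∀ {a b} → b ≢ dual ν a → form F ν (A a) (A b) ≡ 0#
        A-orthogonal {a} {b} b≢a* = to-⊥ (unitᵥ a) (unitᵥ b)
          (trans (form-unitˡ a (unit F b)) (trans (cong (sgn ν a *_) (unit-off b≢a*)) (zeroʳ _)))

        A-paired : ∀ a → form F ν (A a) (A (dual ν a)) ≢ 0#
        A-paired a A⊥A = sgn≢0 ν a (begin
          sgn ν a                                      ≡⟨ *-identityʳ _ ⟨
          sgn ν a * 1#                                 ≡⟨ cong (sgn ν a *_) (unit-diagonal F (dual ν a)) ⟨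
          sgn ν a * unit F (dual ν a) (dual ν a)       ≡⟨ form-unitˡ a (unit F (dual ν a)) ⟨
          form F ν (unit F a) (unit F (dual ν a))      ≡⟨ from-⊥ (unitᵥ a) (unitᵥ (dual ν a)) A⊥A ⟩
          0#                                           ∎)

        -- One factor per hyperbolic pair suffices to bring the value of the form on the images of
        -- eᵢ and fᵢ to 1, so it is placed entirely on fᵢ.
        r : Row F N
        r = interleave ν (λ _ → 1#) (λ i → inv (A-paired (eIndex i)))

        r-e : ∀ i → r (eIndex i) ≡ 1#
        r-e = interleave-e ν (λ _ → 1#) _

        r-f : ∀ i → r (fIndex i) ≡ inv (A-paired (eIndex i))
        r-f = interleave-f ν (λ _ → 1#) _

        r≢0 : ∀ a → r a ≢ 0#
        r≢0 = coordinate-elim ν _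
          (λ i r≡0 → 1≢0 (trans (sym (r-e i)) r≡0))
          (λ i r≡0 → inv≢0 (A-paired (eIndex i)) (trans (sym (r-f i)) r≡0))

        Normalised : Fin N → Set c
        Normalised a = r a * (r (dual ν a) * form F ν (A a) (A (dual ν a))) ≡ sgn ν a

        normalised-dual : ∀ {a} → Normalised a → Normalised (dual ν a)
        normalised-dual {a} ra = begin
          r (dual ν a) * (r (dual ν (dual ν a)) * form F ν (A (dual ν a)) (A (dual ν (dual ν a))))
            ≡⟨ cong (λ b → r (dual ν a) * (r b * form F ν (A (dual ν a)) (A b))) (dual-involutive ν a) ⟩
          r (dual ν a) * (r a * form F ν (A (dual ν a)) (A a))
            ≡⟨ x*yz≡y*xz _ _ _ ⟩
          r a * (r (dual ν a) * form F ν (A (dual ν a)) (A a))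
            ≡⟨ cong (λ t → r a * (r (dual ν a) * t)) (form-antisym F ν (A a) (A (dual ν a))) ⟩
          r a * (r (dual ν a) * - form F ν (A a) (A (dual ν a)))
            ≡⟨ cong (r a *_) (-‿distribʳ-* _ _) ⟨
          r a * - (r (dual ν a) * form F ν (A a) (A (dual ν a)))
            ≡⟨ -‿distribʳ-* _ _ ⟨
          - (r a * (r (dual ν a) * form F ν (A a) (A (dual ν a))))
            ≡⟨ cong -_ ra ⟩
          - sgn ν a
            ≡⟨ sgn-dual ν a ⟨
          sgn ν (dual ν a) ∎

        normalised-e : ∀ (i : Fin ν) → Normalised (eIndex i)
        normalised-e i = begin
          r a * (r (dual ν a) * form F ν (A a) (A (dual ν a)))
            ≡⟨ cong₂ (λ x y → x * (y * form F ν (A a) (A (dual ν a)))) (r-e i)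
                 (trans (cong r (dual-e ν i)) (r-f i)) ⟩
          1# * (inv (A-paired a) * form F ν (A a) (A (dual ν a)))
            ≡⟨ *-identityˡ _ ⟩
          inv (A-paired a) * form F ν (A a) (A (dual ν a))
            ≡⟨ invˡ (A-paired a) ⟩
          1#
            ≡⟨ sgn-e ν i ⟨
          sgn ν a ∎
          where
          a = eIndex i

        normalised : ∀ a → Normalised a
        normalised = coordinate-elim ν Normalised normalised-e
          (λ i → subst Normalised (dual-e ν i) (normalised-dual (normalised-e i)))

        T : Matrix F N N
        T a i = r a * A a i

        T-form : ∀ a b → form F ν (T a) (T b) ≡ form F ν (unit F a) (unit F b)
        T-form a b = trans (trans (form-·ˡ (r a) (A a) (T b)) (cong (r a *_) (form-·ʳ (r b) (A a) (A b))))
          (trans (scaled b) (sym (form-unitˡ a (unit F b))))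
          where
          scaled : ∀ b → r a * (r b * form F ν (A a) (A b)) ≡ sgn ν a * unit F b (dual ν a)
          scaled b with b Fin.≟ dual ν a
          ... | yes refl = trans (normalised a) (sym (*-identityʳ _))
          ... | no b≢a*  = trans
            (trans (cong (λ t → r a * (r b * t)) (A-orthogonal b≢a*)) (trans (cong (r a *_) (zeroʳ _)) (zeroʳ _)))
            (sym (zeroʳ _))

        -- The coefficients of a vector in a symplectic basis are read off by pairing with the dual
        -- basis vectors, which gives the inverse of `g` explicitly.
        g g⁻¹ : Row F N → Row F N
        g α = _ᵣ*_ F α T
        g⁻¹ v a = sgn ν a * form F ν v (T (dual ν a))

        g-T : ∀ α b → form F ν (g α) (T b) ≡ form F ν α (unit F b)
        g-T α b = trans (form-∑ˡ α T (T b)) (trans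
          (sum-cong-≗ (λ a → cong (α a *_) (trans (T-form a b) (form-unitˡ a (unit F b)))))
          (sym (form-dual ν α (unit F b))))

        g-isometry : ∀ α β → form F ν (g α) (g β) ≡ form F ν α β
        g-isometry α β = trans (form-∑ʳ β T (g α)) (sum-cong-≗ (λ b →
          trans (cong (β b *_) (trans (g-T α b) (∑-unitʳ b (_ᵣ*_ F α (K F ν))))) (*-comm _ _)))

        g⁻¹-g : ∀ α i → g⁻¹ (g α) i ≡ α i
        g⁻¹-g α i = begin
          sgn ν i * form F ν (g α) (T (dual ν i))       ≡⟨ cong (sgn ν i *_) (trans (g-T α _) (form-unitʳ α i)) ⟩
          sgn ν i * (sgn ν i * α i)                     ≡⟨ *-assoc _ _ _ ⟨
          (sgn ν i * sgn ν i) * α i                     ≡⟨ cong (_* α i) (sgn² ν i) ⟩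
          1# * α i                                      ≡⟨ *-identityˡ _ ⟩
          α i                                           ∎

        -- Instead of a dimension count, the defect `w` of the right inverse law is shown to be
        -- orthogonal to every row of `T`, hence to every `A b`, and so to vanish.
        g-g⁻¹ : ∀ v i → g (g⁻¹ v) i ≡ v i
        g-g⁻¹ v i = sym (x-y≡0⇒x≡y (A-nondegenerate w w⊥A i))
          where
          w : Row F N
          w j = v j + - g (g⁻¹ v) j

          same : ∀ a → form F ν (g (g⁻¹ v)) (T (dual ν a)) ≡ form F ν v (T (dual ν a))
          same a = begin
            form F ν (g (g⁻¹ v)) (T (dual ν a))                  ≡⟨ g-T (g⁻¹ v) _ ⟩
            form F ν (g⁻¹ v) (unit F (dual ν a))                 ≡⟨ form-unitʳ (g⁻¹ v) a ⟩
            sgn ν a * (sgn ν a * form F ν v (T (dual ν a)))      ≡⟨ *-assoc _ _ _ ⟨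
            (sgn ν a * sgn ν a) * form F ν v (T (dual ν a))      ≡⟨ cong (_* form F ν v (T (dual ν a))) (sgn² ν a) ⟩
            1# * form F ν v (T (dual ν a))                       ≡⟨ *-identityˡ _ ⟩
            form F ν v (T (dual ν a))                            ∎

          w⊥A : ∀ b → form F ν w (A b) ≡ 0#
          w⊥A b = x*y≡0⇒y≡0 (r≢0 b) (begin
            r b * form F ν w (A b)    ≡⟨ form-·ʳ (r b) w (A b) ⟨
            form F ν w (T b)          ≡⟨ form-subˡ v (g (g⁻¹ v)) (T b) ⟩
            form F ν v (T b) + - form F ν (g (g⁻¹ v)) (T b)
              ≡⟨ x≡y⇒x-y≡0 (sym (subst (λ c → form F ν (g (g⁻¹ v)) (T c) ≡ form F ν v (T c))
                   (dual-involutive ν b) (same (dual ν b)))) ⟩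
            0#                        ∎)

        collineation : Collineation
        collineation = record
          { θ = id ; θ⁻¹ = id ; θ-0 = refl ; θ⁻¹-0 = refl
          ; g = g ; g⁻¹ = g⁻¹
          ; g-homo = λ {α} {β} {k} α≡kβ j → begin
              sum (λ i → α i * T i j)        ≡⟨ sum-cong-≗ (λ i → trans (cong (_* T i j) (α≡kβ i)) (*-assoc k _ _)) ⟩
              sum (λ i → k * (β i * T i j))  ≡⟨ *-distribˡ-sum k (λ i → β i * T i j) ⟨
              k * sum (λ i → β i * T i j)    ∎
          ; g⁻¹-homo = λ {α} {β} {k} α≡kβ a → trans
              (cong (sgn ν a *_) (trans (form-cong α≡kβ (λ _ → refl)) (form-·ˡ k β _)))
              (x*yz≡y*xz _ _ _)
          ; g-g⁻¹ = g-g⁻¹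
          ; g⁻¹-g = g⁻¹-g
          ; ⊥⇒⊥ = λ α β α⊥β → trans (g-isometry α β) α⊥β
          ; ⊥⇐⊥ = λ α β gα⊥gβ → trans (sym (g-isometry α β)) gα⊥gβ
          }

        ρ : Group.Carrier (Aut-Sp F ν)
        ρ = Collineation.automorphism collineation

        module ρ = Automorphism ρ

        fixes : ∀ a → proj₁ (ρ.from (to (unitᵥ a))) ≈ unit F a
        fixes a = Inverse.inverseʳ (proj₁ ρ) {unitᵥ a} {to (unitᵥ a)}
          -- Row `a` of `T` is `r a` times `A a`, so `ρ` and `σ` send this basis line to the same
          -- line.
          (≈-sym (proportional (r≢0 a) (λ j → ∑-unitˡ a (λ i → T i j))))

      symplectic-decomposition : ∃₂ λ ρ τ → PSp F ν ρ × FixesBasis F ν τ ×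
        Group._≈_ (Aut-Sp F ν) σ (Group._∙_ (Aut-Sp F ν) ρ τ)
      symplectic-decomposition =
        ρ , Group._∙_ (Aut-Sp F ν) (Group._⁻¹ (Aut-Sp F ν) ρ) σ
          , (T , (λ a b → trans (T-form a b) (K-form a b)) , (λ x → ≈-refl))
          , (λ i → fixes (eIndex i) , fixes (fIndex i))
          , (λ x → ≈-sym (ρ.to-from (to x)))

    -- Ratios of coordinates under an automorphism fixing the basis.

    -- Test vectors. For distinct indices the entry at `a` is 1, so `s` is exactly the ratio of the
    -- entry at `b` to the entry at `a`.
    vec₂ : (a b : Fin N) → Carrier → Row F N
    vec₂ a b s i = s * unit F b i + unit F a i

    vec₃ : (a b d : Fin N) → Carrier → Carrier → Row F N
    vec₃ a b d s t i = t * unit F d i + vec₂ a b s i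

    addUnit-off : ∀ {b i : Fin N} k x → b ≢ i → k * unit F b i + x ≡ x
    addUnit-off k x b≢i =
      trans (cong (_+ x) (trans (cong (k *_) (unit-off b≢i)) (zeroʳ k))) (+-identityˡ x)

    addUnit-on : ∀ (b : Fin N) k {x} → x ≡ 0# → k * unit F b b + x ≡ k
    addUnit-on b k x≡0 = trans
      (cong₂ _+_ (trans (cong (k *_) (unit-diagonal F b)) (*-identityʳ k)) x≡0) (+-identityʳ k)

    vec₂-at₁ : ∀ {a b} s → a ≢ b → vec₂ a b s a ≡ 1#
    vec₂-at₁ {a} s a≢b = trans (addUnit-off s _ (a≢b ∘ sym)) (unit-diagonal F a)

    vec₂-at₂ : ∀ {a b} s → a ≢ b → vec₂ a b s b ≡ s
    vec₂-at₂ {a} {b} s a≢b = addUnit-on b s (unit-off a≢b)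

    module _ {a b d : Fin N} (s t : Carrier) (a≢b : a ≢ b) (a≢d : a ≢ d) (b≢d : b ≢ d) where
      vec₃-at₁ : vec₃ a b d s t a ≡ 1#
      vec₃-at₁ = trans (addUnit-off t _ (a≢d ∘ sym)) (vec₂-at₁ s a≢b)

      vec₃-at₂ : vec₃ a b d s t b ≡ s
      vec₃-at₂ = trans (addUnit-off t _ (b≢d ∘ sym)) (vec₂-at₂ s a≢b)

      vec₃-at₃ : vec₃ a b d s t d ≡ t
      vec₃-at₃ = addUnit-on d t (trans (addUnit-off s _ b≢d) (unit-off a≢d))

      vec₃-off : ∀ {i} → a ≢ i → b ≢ i → d ≢ i → vec₃ a b d s t i ≡ 0#
      vec₃-off a≢i b≢i d≢i = trans (addUnit-off t _ d≢i) (trans (addUnit-off s _ b≢i) (unit-off a≢i))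

    vec₂ᵥ : ∀ {a b} → a ≢ b → Carrier → V
    vec₂ᵥ {a} {b} a≢b s = vec₂ a b s , λ v≡0 → 1≢0 (trans (sym (vec₂-at₁ s a≢b)) (v≡0 a))

    vec₃ᵥ : ∀ {a b d} → a ≢ b → a ≢ d → b ≢ d → Carrier → Carrier → V
    vec₃ᵥ {a} {b} {d} a≢b a≢d b≢d s t = vec₃ a b d s t ,
      λ v≡0 → 1≢0 (trans (sym (vec₃-at₁ s t a≢b a≢d b≢d)) (v≡0 a))

    module FixingBasis (σ : Group.Carrier (E F ν)) where
      open Automorphism (proj₁ σ) public

      to-unit : ∀ a → proj₁ (to (unitᵥ a)) ≈ unit F a
      to-unit = coordinate-elim ν _ (proj₁ ∘ proj₂ σ) (proj₂ ∘ proj₂ σ)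

      to-⊥unit : ∀ x a → form F ν (proj₁ x) (unit F a) ≡ 0# → form F ν (proj₁ (to x)) (unit F a) ≡ 0#
      to-⊥unit x a x⊥a = form-∈ʳ F ν (≈⇒∈ (≈-sym (to-unit a))) (to-⊥ x (unitᵥ a) x⊥a)

      from-⊥unit : ∀ x a → form F ν (proj₁ (to x)) (unit F a) ≡ 0# → form F ν (proj₁ x) (unit F a) ≡ 0#
      from-⊥unit x a x⊥a = from-⊥ x (unitᵥ a) (form-∈ʳ F ν (≈⇒∈ (to-unit a)) x⊥a)

      private
        ⊥unit⇒0 : ∀ α a → form F ν α (unit F (dual ν a)) ≡ 0# → α a ≡ 0#
        ⊥unit⇒0 α a α⊥a = x*y≡0⇒y≡0 (sgn≢0 ν a) (trans (sym (form-unitʳ α a)) α⊥a)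

        0⇒⊥unit : ∀ α a → α a ≡ 0# → form F ν α (unit F (dual ν a)) ≡ 0#
        0⇒⊥unit α a αa≡0 = trans (form-unitʳ α a) (trans (cong (sgn ν a *_) αa≡0) (zeroʳ _))

      -- The vanishing of coordinate `a` is orthogonality to the basis vector at `dual ν a`, whose
      -- line is fixed.
      to-0 : ∀ (x : V) a → proj₁ x a ≡ 0# → proj₁ (to x) a ≡ 0#
      to-0 x a xa≡0 = ⊥unit⇒0 _ a (to-⊥unit x (dual ν a) (0⇒⊥unit _ a xa≡0))

      to-≢0 : ∀ (x : V) a → proj₁ x a ≢ 0# → proj₁ (to x) a ≢ 0#
      to-≢0 x a xa≢0 x′a≡0 = xa≢0 (⊥unit⇒0 _ a (from-⊥unit x (dual ν a) (0⇒⊥unit _ a x′a≡0)))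

      -- The condition x b ≡ t * x a says that x is orthogonal to a certain vector D
      -- in the plane of two basis vectors.  Since σ fixes the basis, the image of D
      -- lies in the same plane, so the condition becomes x b ≡ ratio * x a.
      module _ {a b : Fin N} (a≢b : a ≢ b) (t : Carrier) where
        private
          D : Row F N
          D i = sgn ν (dual ν b) * unit F (dual ν b) i + - (t * sgn ν (dual ν a)) * unit F (dual ν a) i

          -- The coefficients of `D` include the signs of their own positions; these square to 1
          -- against the signs of the form, leaving the functional `β b - t * β a`.
          D-form : ∀ β → form F ν D β ≡ β b + - (t * β a)
          D-form β = begin
            form F ν D β
              ≡⟨ form-addˡ (sgn ν (dual ν b)) (dual ν b) _ β ⟩
            sb * (sb * β (dual ν (dual ν b))) + form F ν (λ i → - (t * sa) * unit F (dual ν a) i) β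
              ≡⟨ cong₂ _+_ (strip b) (trans (form-·ˡ (- (t * sa)) _ β) (cong (- (t * sa) *_) (form-unitˡ (dual ν a) β))) ⟩
            β b + - (t * sa) * (sa * β (dual ν (dual ν a)))
              ≡⟨ cong (β b +_) (sym (-‿distribˡ-* (t * sa) _)) ⟩
            β b + - ((t * sa) * (sa * β (dual ν (dual ν a))))
              ≡⟨ cong (λ z → β b + - z) (trans (*-assoc _ _ _) (cong (t *_) (strip a))) ⟩
            β b + - (t * β a) ∎
            where
            sa = sgn ν (dual ν a)
            sb = sgn ν (dual ν b)
            strip : ∀ c → sgn ν (dual ν c) * (sgn ν (dual ν c) * β (dual ν (dual ν c))) ≡ β c
            strip c = trans (sym (*-assoc _ _ _)) (trans
              (cong₂ _*_ (sgn² ν (dual ν c)) (cong β (dual-involutive ν c))) (*-identityˡ _))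

          D-unit-b : form F ν D (unit F b) ≡ 1#
          D-unit-b = begin
            form F ν D (unit F b)                ≡⟨ D-form (unit F b) ⟩
            unit F b b + - (t * unit F b a)      ≡⟨ cong₂ (λ x y → x + - (t * y)) (unit-diagonal F b) (unit-off (a≢b ∘ sym)) ⟩
            1# + - (t * 0#)                      ≡⟨ cong (λ y → 1# + - y) (zeroʳ t) ⟩
            1# + - 0#                            ≡⟨ cong (1# +_) -0#≈0# ⟩
            1# + 0#                              ≡⟨ +-identityʳ 1# ⟩
            1#                                   ∎

          D-unit-off : ∀ {d} → d ≢ a → d ≢ b → form F ν D (unit F d) ≡ 0#
          D-unit-off {d} d≢a d≢b = trans (D-form (unit F d)) (x≡y⇒x-y≡0 (trans (unit-off d≢b)
            (sym (trans (cong (t *_) (unit-off d≢a)) (zeroʳ t)))))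

          Dᵥ : V
          Dᵥ = D , λ D≡0 → 1≢0 (trans (sym D-unit-b)
            (form-∈ˡ F ν (0# , λ i → trans (D≡0 i) (sym (zeroˡ _))) (form-alternating F ν (unit F b))))

          D′ : Row F N
          D′ = proj₁ (to Dᵥ)

          δ : Row F N
          δ d = form F ν D′ (unit F d)

          δ-off : ∀ {d} → d ≢ a → d ≢ b → δ d ≡ 0#
          δ-off {d} d≢a d≢b = to-⊥unit Dᵥ d (D-unit-off d≢a d≢b)

          -- This makes the image condition solvable for coordinate `b`. It holds because `D` is not
          -- orthogonal to the fixed line of `unit F b`.
          δb≢0 : δ b ≢ 0#
          δb≢0 δb≡0 = 1≢0 (trans (sym D-unit-b) (from-⊥unit Dᵥ b δb≡0))

          D′-form : ∀ β → form F ν D′ β ≡ δ a * β a + δ b * β b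
          D′-form β = trans
            (sum-cong-≗ (λ d → cong (_* β d) (sym (∑-unitʳ d (_ᵣ*_ F D′ (K F ν))))))
            (∑-supported₂ a≢b δ β δ-off)

        -- The solution of `δ a * x a + δ b * x b ≡ 0#` for `x b` in terms of `x a`; the quotient
        -- cancels the unknown scale of the generator `D′`.
        ratio : Carrier
        ratio = inv δb≢0 * - δ a

        private
          balanced : ∀ x → δ a * x + δ b * (ratio * x) ≡ 0#
          balanced x = begin
            δ a * x + δ b * (ratio * x)              ≡⟨ cong (δ a * x +_) (*-assoc _ _ _) ⟨
            δ a * x + (δ b * ratio) * x              ≡⟨ cong (λ z → δ a * x + z * x) (inv-cancelʳ δb≢0 _) ⟩
            δ a * x + - δ a * x                      ≡⟨ cong (δ a * x +_) (-‿distribˡ-* _ _) ⟨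
            δ a * x + - (δ a * x)                    ≡⟨ -‿inverseʳ _ ⟩
            0#                                       ∎

        to-ratio : ∀ (x : V) → proj₁ x b ≡ t * proj₁ x a → proj₁ (to x) b ≡ ratio * proj₁ (to x) a
        to-ratio x xb≡txa = *-cancelˡ δb≢0 (+-cancelˡ (δ a * proj₁ (to x) a) _ _ (begin
          δ a * proj₁ (to x) a + δ b * proj₁ (to x) b            ≡⟨ D′-form (proj₁ (to x)) ⟨
          form F ν D′ (proj₁ (to x))
            ≡⟨ to-⊥ Dᵥ x (trans (D-form (proj₁ x)) (x≡y⇒x-y≡0 xb≡txa)) ⟩
          0#                                                     ≡⟨ balanced _ ⟨
          δ a * proj₁ (to x) a + δ b * (ratio * proj₁ (to x) a)  ∎))

    -- Follow the line of `vec₂ a b t`: its ratio `t` is transformed by `σ` and then by `τ`, while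
    -- the composite returns the same line. Bijectivity thus needs no formula for the ratio.
    ratio-inverse : ∀ (σ τ : Group.Carrier (E F ν)) →
      (∀ x → proj₁ (FixingBasis.to τ (FixingBasis.to σ x)) ≈ proj₁ x) →
      ∀ {a b} (a≢b : a ≢ b) t → FixingBasis.ratio τ a≢b (FixingBasis.ratio σ a≢b t) ≡ t
    ratio-inverse σ τ τσ≈1 {a} {b} a≢b t = begin
      t″               ≡⟨ *-identityʳ t″ ⟨
      t″ * 1#          ≡⟨ cong (t″ *_) (vec₂-at₁ t a≢b) ⟨
      t″ * vec₂ a b t a
        ≡⟨ ≈-ratio (τσ≈1 x) (τ.to-ratio a≢b (σ.ratio a≢b t) (σ.to x)
             (σ.to-ratio a≢b t x (trans (vec₂-at₂ t a≢b) (sym (trans (cong (t *_) (vec₂-at₁ t a≢b)) (*-identityʳ t)))))) ⟨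
      vec₂ a b t b     ≡⟨ vec₂-at₂ t a≢b ⟩
      t                ∎
      where
      module σ = FixingBasis σ
      module τ = FixingBasis τ
      t″ = τ.ratio a≢b (σ.ratio a≢b t)
      x = vec₂ᵥ a≢b t

  -- Affine coordinates on the lines with nonzero first coordinate.

  module FirstCoordinate (n : ℕ) (σ : Group.Carrier (E F (suc n))) where
    open FixingBasis (suc n) σ public

    private
      V : Set c
      V = SimpleGraph.Vertex (SpGraph F (suc n))

      N : ℕ
      N = suc n ℕ* 2

    -- For coordinate `zero` the relation `x₀ = t x₀` with `x₀` nonzero forces `t = 1`. Choosing the
    -- identity there gives e₁ the weight 1.
    coordinateMap : Fin N → Carrier → Carrier
    coordinateMap zero    t = t
    coordinateMap (suc i) t = ratio {zero} {suc i} Fin.0≢1+n t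

    to-coordinate : ∀ (x : V) → proj₁ x zero ≢ 0# → ∀ {i t} → proj₁ x i ≡ t * proj₁ x zero →
      proj₁ (to x) i ≡ coordinateMap i t * proj₁ (to x) zero
    to-coordinate x x₀≢0 {zero} {t} x₀≡tx₀ = sym (trans (cong (_* proj₁ (to x) zero) t≡1) (*-identityˡ _))
      where
      t≡1 : t ≡ 1#
      t≡1 = *-cancelʳ x₀≢0 (trans (sym x₀≡tx₀) (sym (*-identityˡ _)))
    to-coordinate x x₀≢0 {suc i} {t} xᵢ≡tx₀ = to-ratio Fin.0≢1+n t x xᵢ≡tx₀

    coordinateMap-unique : ∀ (x : V) → proj₁ x zero ≢ 0# → ∀ {i t t′} → proj₁ x i ≡ t * proj₁ x zero →
      proj₁ (to x) i ≡ t′ * proj₁ (to x) zero → coordinateMap i t ≡ t′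
    coordinateMap-unique x x₀≢0 xᵢ≡tx₀ x′ᵢ≡t′x′₀ =
      *-cancelʳ (to-≢0 x zero x₀≢0) (trans (sym (to-coordinate x x₀≢0 xᵢ≡tx₀)) x′ᵢ≡t′x′₀)

    coordinateMap-0 : ∀ i → coordinateMap i 0# ≡ 0#
    coordinateMap-0 zero    = refl
    coordinateMap-0 (suc i) = coordinateMap-unique (unitᵥ (suc n) zero) 1≢0
      (sym (zeroˡ _)) (trans (to-0 (unitᵥ (suc n) zero) (suc i) refl) (sym (zeroˡ _)))

    coordinateMap-1≢0 : ∀ i → coordinateMap i 1# ≢ 0#
    coordinateMap-1≢0 zero = 1≢0
    coordinateMap-1≢0 (suc i) κ≡0 = to-≢0 x (suc i) (λ xᵢ≡0 → 1≢0 (trans (sym xᵢ≡1) xᵢ≡0))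
      (trans (to-coordinate x (λ x₀≡0 → 1≢0 (trans (sym x₀≡1) x₀≡0))
               (trans xᵢ≡1 (sym (trans (*-identityˡ _) x₀≡1))))
        (trans (cong (_* proj₁ (to x) zero) κ≡0) (zeroˡ _)))
      where
      x : V
      x = vec₂ᵥ (suc n) {zero} {suc i} Fin.0≢1+n 1#
      x₀≡1 : proj₁ x zero ≡ 1#
      x₀≡1 = vec₂-at₁ (suc n) {zero} {suc i} 1# Fin.0≢1+n
      xᵢ≡1 : proj₁ x (suc i) ≡ 1#
      xᵢ≡1 = vec₂-at₂ (suc n) {zero} {suc i} 1# Fin.0≢1+n

  coordinatePermutation : ∀ n → Group.Carrier (E F (suc n)) → Fin (suc (n ℕ* 2)) → Carrier ↔ Carrier
  coordinatePermutation n σ i = mk↔ₛ′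
    (FirstCoordinate.coordinateMap n σ (suc i)) (FirstCoordinate.coordinateMap n σ⁻¹ (suc i))
    (ratio-inverse (suc n) σ⁻¹ σ (FirstCoordinate.to-from n σ) {zero} {suc i} Fin.0≢1+n)
    (ratio-inverse (suc n) σ σ⁻¹ (FirstCoordinate.from-to n σ) {zero} {suc i} Fin.0≢1+n)
    where
    σ⁻¹ = Group._⁻¹ (E F (suc n)) σ

  -- Rank one: permutations of the nonzero slopes.

  -- For ν = 1 the graph is complete, so every permutation of the lines
  -- [1 , t] with t ≢ 0 extends to an automorphism.
  module RankOne where
    -- Acts on slopes: [1 , t] goes to [1 , p t], and the line with first coordinate 0 stays put.
    -- Multiplying back by `α zero` makes the map homogeneous on generators.
    stretch : (Carrier → Carrier) → Row F 2 → Row F 2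
    stretch p α zero = α zero
    stretch p α (suc zero) with α zero ≟ 0#
    ... | yes _   = α (suc zero)
    ... | no α₀≢0 = α zero * p (inv α₀≢0 * α (suc zero))

    stretch-0 : ∀ p α → α zero ≡ 0# → ∀ i → stretch p α i ≡ α i
    stretch-0 p α α₀≡0 zero = refl
    stretch-0 p α α₀≡0 (suc zero) with α zero ≟ 0#
    ... | yes _   = refl
    ... | no α₀≢0 = contradiction α₀≡0 α₀≢0

    stretch-≢0 : ∀ p α → α zero ≢ 0# → ∀ {t} → α (suc zero) ≡ α zero * t →
      stretch p α (suc zero) ≡ α zero * p t
    stretch-≢0 p α α₀≢0 {t} α₁≡α₀t with α zero ≟ 0#
    ... | yes α₀≡0  = contradiction α₀≡0 α₀≢0
    ... | no α₀≢0′ = cong (λ s → α zero * p s)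
      (trans (cong (inv α₀≢0′ *_) α₁≡α₀t) (inv-cancelˡ α₀≢0′ t))

    slope : ∀ {α : Row F 2} (α₀≢0 : α zero ≢ 0#) → α (suc zero) ≡ α zero * (inv α₀≢0 * α (suc zero))
    slope α₀≢0 = sym (inv-cancelʳ α₀≢0 _)

    stretch-cong : ∀ {p p′} → (∀ t → p t ≡ p′ t) → ∀ α i → stretch p α i ≡ stretch p′ α i
    stretch-cong p≗p′ α zero = refl
    stretch-cong p≗p′ α (suc zero) with α zero ≟ 0#
    ... | yes _ = refl
    ... | no _  = cong (α zero *_) (p≗p′ _)

    stretch-∘ : ∀ p p′ α i → stretch p (stretch p′ α) i ≡ stretch (p ∘ p′) α i
    stretch-∘ p p′ α zero = refl
    stretch-∘ p p′ α (suc zero) = case α zero ≟ 0# of λ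
      { (yes α₀≡0) → trans (stretch-0 p (stretch p′ α) α₀≡0 (suc zero))
          (trans (stretch-0 p′ α α₀≡0 (suc zero)) (sym (stretch-0 (p ∘ p′) α α₀≡0 (suc zero))))
      ; (no α₀≢0) → trans
          (stretch-≢0 p (stretch p′ α) α₀≢0 (stretch-≢0 p′ α α₀≢0 (slope {α} α₀≢0)))
          (sym (stretch-≢0 (p ∘ p′) α α₀≢0 (slope {α} α₀≢0)))
      }

    stretch-id : ∀ {p} → (∀ t → p t ≡ t) → ∀ α i → stretch p α i ≡ α i
    stretch-id p≗id α zero = refl
    stretch-id p≗id α (suc zero) with α zero ≟ 0#
    ... | yes _   = refl
    ... | no α₀≢0 = trans (cong (α zero *_) (p≗id _)) (inv-cancelʳ α₀≢0 _)

    stretch-homo : ∀ p → Homogeneous 1 id (stretch p)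
    stretch-homo p α≡kβ zero = α≡kβ zero
    stretch-homo p {α} {β} {k} α≡kβ (suc zero) with β zero ≟ 0# | α zero ≟ 0#
    ... | yes β₀≡0 | yes α₀≡0 = α≡kβ (suc zero)
    ... | yes β₀≡0 | no α₀≢0  =
      contradiction (trans (α≡kβ zero) (trans (cong (k *_) β₀≡0) (zeroʳ k))) α₀≢0
    ... | no β₀≢0  | yes α₀≡0 = trans (α≡kβ (suc zero)) (trans (cong (_* _) k≡0)
      (trans (zeroˡ _) (sym (trans (cong (_* _) k≡0) (zeroˡ _)))))
      where
      k≡0 : k ≡ 0#
      k≡0 = x*y≡0⇒y≡0 β₀≢0 (trans (*-comm _ _) (trans (sym (α≡kβ zero)) α₀≡0))
    ... | no β₀≢0  | no α₀≢0  = begin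
      α zero * p (inv α₀≢0 * α (suc zero))             ≡⟨ cong₂ (λ x s → x * p s) (α≡kβ zero) same ⟩
      (k * β zero) * p (inv β₀≢0 * β (suc zero))       ≡⟨ *-assoc _ _ _ ⟩
      k * (β zero * p (inv β₀≢0 * β (suc zero)))       ∎
      where
      same : inv α₀≢0 * α (suc zero) ≡ inv β₀≢0 * β (suc zero)
      same = *-cancelˡ α₀≢0 (begin
        α zero * (inv α₀≢0 * α (suc zero))             ≡⟨ inv-cancelʳ α₀≢0 _ ⟩
        α (suc zero)                                   ≡⟨ α≡kβ (suc zero) ⟩
        k * β (suc zero)                               ≡⟨ cong (k *_) (inv-cancelʳ β₀≢0 _) ⟨
        k * (β zero * (inv β₀≢0 * β (suc zero)))       ≡⟨ *-assoc _ _ _ ⟨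
        (k * β zero) * (inv β₀≢0 * β (suc zero))       ≡⟨ cong (_* _) (α≡kβ zero) ⟨
        α zero * (inv β₀≢0 * β (suc zero))             ∎)

    -- For ν = 1 the form is the determinant of the two rows, so orthogonality is linear dependence,
    -- which every homogeneous bijection respects. The disjunction accounts for zero rows.
    ⊥⇒∈ : ∀ α β → form F 1 α β ≡ 0# → α ∈ β ⊎ β ∈ α
    ⊥⇒∈ α β α⊥β with Fin.all? (λ i → β i ≟ 0#)
    ... | yes β≡0 = inj₂ (0# , λ i → trans (β≡0 i) (sym (zeroˡ _)))
    ... | no β≢0  with pivot β≢0
    ...   | j , βⱼ≢0 = inj₁ (inv βⱼ≢0 * α j , λ i → *-cancelˡ βⱼ≢0 (begin
      β j * α i                        ≡⟨ *-comm _ _ ⟩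
      α i * β j                        ≡⟨ cross i j ⟩
      α j * β i                        ≡⟨ inv-cancelʳ βⱼ≢0 _ ⟨
      β j * (inv βⱼ≢0 * (α j * β i))   ≡⟨ cong (β j *_) (*-assoc _ _ _) ⟨
      β j * (inv βⱼ≢0 * α j * β i)     ∎))
      where
      α₀β₁≡α₁β₀ : α zero * β (suc zero) ≡ α (suc zero) * β zero
      α₀β₁≡α₁β₀ = x-y≡0⇒x≡y (begin
        α zero * β (suc zero) + - (α (suc zero) * β zero)         ≡⟨ +-comm _ _ ⟩
        - (α (suc zero) * β zero) + α zero * β (suc zero)
          ≡⟨ cong₂ _+_ (-‿distribˡ-* _ _) (sym (+-identityʳ _)) ⟩
        - α (suc zero) * β zero + (α zero * β (suc zero) + 0#)    ≡⟨ form-suc F 0 α β ⟨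
        form F 1 α β                                              ≡⟨ α⊥β ⟩
        0#                                                        ∎)

      cross : ∀ i j → α i * β j ≡ α j * β i
      cross zero       zero       = refl
      cross zero       (suc zero) = α₀β₁≡α₁β₀
      cross (suc zero) zero       = sym α₀β₁≡α₁β₀
      cross (suc zero) (suc zero) = refl

    ∈⇒⊥ : ∀ α β → α ∈ β ⊎ β ∈ α → form F 1 α β ≡ 0#
    ∈⇒⊥ α β (inj₁ α∈β) = form-∈ˡ F 1 {α} {β} {β} α∈β (form-alternating F 1 β)
    ∈⇒⊥ α β (inj₂ β∈α) = form-∈ʳ F 1 {α} {β} {α} β∈α (form-alternating F 1 α)

    stretch-∈ : ∀ p α β → α ∈ β → stretch p α ∈ stretch p β
    stretch-∈ p α β (k , α≡kβ) = k , stretch-homo p {α} {β} {k} α≡kβ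

    collineation : Carrier ↔ Carrier → Collineation 1
    collineation π = record
      { θ = id ; θ⁻¹ = id ; θ-0 = refl ; θ⁻¹-0 = refl
      ; g = g ; g⁻¹ = g⁻¹
      ; g-homo = stretch-homo p ; g⁻¹-homo = stretch-homo p⁻¹
      ; g-g⁻¹ = λ α i → trans (stretch-∘ p p⁻¹ α i) (stretch-id (λ _ → Inverse.inverseˡ π refl) α i)
      ; g⁻¹-g = g⁻¹-g
      ; ⊥⇒⊥ = λ α β α⊥β → ∈⇒⊥ (g α) (g β) (Sum.map (stretch-∈ p α β) (stretch-∈ p β α) (⊥⇒∈ α β α⊥β))
      ; ⊥⇐⊥ = λ α β gα⊥gβ → ∈⇒⊥ α β (Sum.map (back α β) (back β α) (⊥⇒∈ (g α) (g β) gα⊥gβ))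
      }
      where
      p = Inverse.to π
      p⁻¹ = Inverse.from π
      g = stretch p
      g⁻¹ = stretch p⁻¹

      g⁻¹-g : ∀ α i → g⁻¹ (g α) i ≡ α i
      g⁻¹-g α i = trans (stretch-∘ p⁻¹ p α i) (stretch-id (λ _ → Inverse.inverseʳ π refl) α i)

      back : ∀ α β → g α ∈ g β → α ∈ β
      back α β gα∈gβ with stretch-∈ p⁻¹ (g α) (g β) gα∈gβ
      ... | k , eq = k , λ i → trans (sym (g⁻¹-g α i)) (trans (eq i) (cong (k *_) (g⁻¹-g β i)))

    ofPermutation : (π : Carrier ↔ Carrier) → Inverse.to π 0# ≡ 0# → Group.Carrier (E F 1)
    ofPermutation π π0≡0 = Collineation.automorphism (collineation π) , λ
      { zero → ≗⇒≈ (λ { zero → refl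
                      ; (suc zero) → trans (stretch-≢0 p (unit F zero) 1≢0 (sym (zeroʳ _)))
                                       (trans (cong (1# *_) π0≡0) (zeroʳ _)) })
             , ≗⇒≈ (stretch-0 p (unit F (suc zero)) refl) }
      where
      p = Inverse.to π

    second≢0 : ∀ {α : Row F 2} → NonZeroRow F α → α zero ≡ 0# → α (suc zero) ≢ 0#
    second≢0 α≢0 α₀≡0 α₁≡0 = α≢0 λ { zero → α₀≡0 ; (suc zero) → α₁≡0 }

    stretch-≈-0 : ∀ p (α β : Row F 2) → α zero ≡ 0# → β zero ≡ 0# →
      α (suc zero) ≢ 0# → β (suc zero) ≢ 0# → stretch p α ≈ β
    stretch-≈-0 p α β α₀≡0 β₀≡0 α₁≢0 β₁≢0 = proportional (*-≢0 F α₁≢0 (inv≢0 β₁≢0)) λ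
      { zero → trans α₀≡0 (sym (trans (cong (α (suc zero) * inv β₁≢0 *_) β₀≡0) (zeroʳ _)))
      ; (suc zero) → begin
          stretch p α (suc zero)                      ≡⟨ stretch-0 p α α₀≡0 (suc zero) ⟩
          α (suc zero)                                ≡⟨ *-identityʳ _ ⟨
          α (suc zero) * 1#                           ≡⟨ cong (α (suc zero) *_) (invˡ β₁≢0) ⟨
          α (suc zero) * (inv β₁≢0 * β (suc zero))    ≡⟨ *-assoc _ _ _ ⟨
          α (suc zero) * inv β₁≢0 * β (suc zero)      ∎ }

    stretch-≈-≢0 : ∀ p (α β : Row F 2) t → α zero ≢ 0# → β zero ≢ 0# →
      α (suc zero) ≡ α zero * t → β (suc zero) ≡ p t * β zero → stretch p α ≈ β
    stretch-≈-≢0 p α β t α₀≢0 β₀≢0 α₁≡α₀t β₁≡ptβ₀ = proportional (*-≢0 F α₀≢0 (inv≢0 β₀≢0)) λ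
      { zero → sym (trans (*-assoc _ _ _) (trans (cong (α zero *_) (invˡ β₀≢0)) (*-identityʳ _)))
      ; (suc zero) → begin
          stretch p α (suc zero)                      ≡⟨ stretch-≢0 p α α₀≢0 α₁≡α₀t ⟩
          α zero * p t                                ≡⟨ cong (α zero *_) (inv-cancelˡ β₀≢0 (p t)) ⟨
          α zero * (inv β₀≢0 * (β zero * p t))        ≡⟨ cong (λ z → α zero * (inv β₀≢0 * z)) (trans (*-comm _ _) (sym β₁≡ptβ₀)) ⟩
          α zero * (inv β₀≢0 * β (suc zero))          ≡⟨ *-assoc _ _ _ ⟨
          α zero * inv β₀≢0 * β (suc zero)            ∎ }

    ofPermutation-coordinateMap : ∀ σ π (π0≡0 : Inverse.to π 0# ≡ 0#) →
      (∀ t → Inverse.to π t ≡ FirstCoordinate.coordinateMap 0 σ (suc zero) t) →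
      Group._≈_ (E F 1) (ofPermutation π π0≡0) σ
    ofPermutation-coordinateMap σ π π0≡0 p≗ĝ x = case proj₁ x zero ≟ 0# of λ
      { (yes x₀≡0) → stretch-≈-0 p (proj₁ x) x′ x₀≡0 (to-0 x zero x₀≡0)
          (second≢0 (proj₂ x) x₀≡0) (to-≢0 x (suc zero) (second≢0 (proj₂ x) x₀≡0))
      ; (no x₀≢0) → let t = inv x₀≢0 * proj₁ x (suc zero) in
          stretch-≈-≢0 p (proj₁ x) x′ t x₀≢0 (to-≢0 x zero x₀≢0) (slope {proj₁ x} x₀≢0)
            (trans (to-coordinate x x₀≢0 {suc zero} {t} (trans (slope {proj₁ x} x₀≢0) (*-comm _ _)))
              (cong (_* x′ zero) (sym (p≗ĝ t))))
      }
      where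
      open FirstCoordinate 0 σ
      p = Inverse.to π

      x′ : Row F 2
      x′ = proj₁ (to x)

    point : Carrier → SimpleGraph.Vertex (SpGraph F 1)
    point t = (λ { zero → 1# ; (suc zero) → t }) , λ pt≡0 → 1≢0 (pt≡0 zero)

    module _ {m : ℕ} (enum : Fin (suc m) ↔ Carrier) (enum-0 : Inverse.to enum zero ≡ 0#) where
      private
        toF = Inverse.to enum
        fromF = Inverse.from enum

        toF-fromF : ∀ x → toF (fromF x) ≡ x
        toF-fromF x = Inverse.inverseˡ enum refl

        fromF-toF : ∀ i → fromF (toF i) ≡ i
        fromF-toF i = Inverse.inverseʳ enum refl

        fromF-0 : fromF 0# ≡ zero
        fromF-0 = trans (cong fromF (sym enum-0)) (fromF-toF zero)

      -- Index `zero` stands for `0#`, so the other indices enumerate the nonzero slopes. Adding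
      -- `zero` as a fixed point keeps slope 0, the line of e₁, in place.
      onField : Permutation m m → Carrier ↔ Carrier
      onField s = enum ↔-∘ (lift₀ s ↔-∘ ↔-sym enum)

      private
        p : Permutation m m → Carrier → Carrier
        p s = Inverse.to (onField s)

      onField-0 : ∀ s → p s 0# ≡ 0#
      onField-0 s = trans (cong (λ i → toF (lift₀ s ⟨$⟩ʳ i)) fromF-0) enum-0

      fromSym : Permutation m m → Group.Carrier (E F 1)
      fromSym s = ofPermutation (onField s) (onField-0 s)

      fromSym-cong : ∀ s t → (∀ j → s ⟨$⟩ʳ j ≡ t ⟨$⟩ʳ j) → Group._≈_ (E F 1) (fromSym s) (fromSym t)
      fromSym-cong s t s≈t x = ≗⇒≈ (stretch-cong (λ y → cong toF (lift₀-cong s t s≈t (fromF y))) (proj₁ x))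

      fromSym-homo : ∀ s t → Group._≈_ (E F 1) (fromSym (s ↔-∘ t)) (Group._∙_ (E F 1) (fromSym s) (fromSym t))
      fromSym-homo s t x = ≗⇒≈ (λ i → trans
        (stretch-cong (λ y → cong toF (trans (sym (lift₀-comp t s (fromF y)))
          (cong (lift₀ s ⟨$⟩ʳ_) (sym (fromF-toF _))))) (proj₁ x) i)
        (sym (stretch-∘ (p s) (p t) (proj₁ x) i)))

      fromSym-injective : ∀ s t → Group._≈_ (E F 1) (fromSym s) (fromSym t) → ∀ j → s ⟨$⟩ʳ j ≡ t ⟨$⟩ʳ j
      fromSym-injective s t eq j = Fin.suc-injective (begin
        suc (s ⟨$⟩ʳ j)              ≡⟨ cong (lift₀ s ⟨$⟩ʳ_) (fromF-toF (suc j)) ⟨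
        lift₀ s ⟨$⟩ʳ fromF (toF (suc j))  ≡⟨ fromF-toF _ ⟨
        fromF (p s (toF (suc j)))   ≡⟨ cong fromF (p≗ (toF (suc j))) ⟩
        fromF (p t (toF (suc j)))   ≡⟨ fromF-toF _ ⟩
        lift₀ t ⟨$⟩ʳ fromF (toF (suc j))  ≡⟨ cong (lift₀ t ⟨$⟩ʳ_) (fromF-toF (suc j)) ⟩
        suc (t ⟨$⟩ʳ j)              ∎)
        where
        stretch-point : ∀ s y → stretch (p s) (proj₁ (point y)) (suc zero) ≡ p s y
        stretch-point s y = trans
          (stretch-≢0 (p s) (proj₁ (point y)) 1≢0 (sym (*-identityˡ y))) (*-identityˡ _)

        p≗ : ∀ y → p s y ≡ p t y
        p≗ y = sym (trans (sym (stretch-point t y)) (trans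
          (≈-ratio {a = zero} {suc zero} (eq (point y))
            (trans (stretch-point s y) (sym (*-identityʳ _))))
          (*-identityʳ _)))

      -- The coordinate map of `σ` fixes 0, so the permutation `P` it induces on indices fixes
      -- `zero` and is the lift of its restriction `remove zero P`.
      fromSym-surjective : ∀ σ → ∃ λ s → Group._≈_ (E F 1) (fromSym s) σ
      fromSym-surjective σ = remove zero P ,
        ofPermutation-coordinateMap σ (onField (remove zero P)) (onField-0 (remove zero P)) p≗ĝ
        where
        open FirstCoordinate 0 σ

        ĝ : Carrier ↔ Carrier
        ĝ = coordinatePermutation 0 σ zero

        P : Permutation (suc m) (suc m)
        P = ↔-sym enum ↔-∘ (ĝ ↔-∘ enum)

        P-0 : P ⟨$⟩ʳ zero ≡ zero
        P-0 = trans (cong (fromF ∘ Inverse.to ĝ) enum-0)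
          (trans (cong fromF (coordinateMap-0 (suc zero))) fromF-0)

        p≗ĝ : ∀ y → p (remove zero P) y ≡ Inverse.to ĝ y
        p≗ĝ y = trans (cong toF (lift₀-remove P P-0 (fromF y)))
          (trans (toF-fromF _) (cong (Inverse.to ĝ) (toF-fromF y)))

  -- Diagonal semilinear maps and the semidirect product.

  module Semilinear (n : ℕ) where
    private
      ν N : ℕ
      ν = suc n
      N = ν ℕ* 2

    module _ (k : Fin ν → Σ Carrier (_≢ 0#)) where
      -- Scalars act trivially, so e₁ can be given weight 1. The slot `k zero` is then free to hold
      -- the multiplier of the form, which is also the weight of f₁.
      eWeight : Fin ν → Carrier
      eWeight zero    = 1#
      eWeight (suc i) = proj₁ (k (suc i))

      eWeight≢0 : ∀ i → eWeight i ≢ 0#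
      eWeight≢0 zero    = 1≢0
      eWeight≢0 (suc i) = proj₂ (k (suc i))

      -- The weights of eᵢ and fᵢ multiply to k₁ for every i, which makes the
      -- diagonal matrix of weights a similitude of the symplectic form.
      weight : Fin N → Carrier
      weight = interleave ν eWeight (λ i → proj₁ (k zero) * inv (eWeight≢0 i))

      weight-e : ∀ i → weight (eIndex i) ≡ eWeight i
      weight-e = interleave-e ν eWeight _

      weight-ef : ∀ (i : Fin ν) → weight (eIndex i) * weight (fIndex i) ≡ proj₁ (k zero)
      weight-ef i = begin
        weight (eIndex i) * weight (fIndex i)
          ≡⟨ cong₂ _*_ (weight-e i) (interleave-f ν eWeight _ i) ⟩
        eWeight i * (proj₁ (k zero) * inv (eWeight≢0 i))
          ≡⟨ x*yz≡y*xz _ _ _ ⟩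
        proj₁ (k zero) * (eWeight i * inv (eWeight≢0 i))
          ≡⟨ cong (proj₁ (k zero) *_) (invʳ (eWeight≢0 i)) ⟩
        proj₁ (k zero) * 1#
          ≡⟨ *-identityʳ _ ⟩
        proj₁ (k zero) ∎

      weight-dual : ∀ a → weight a * weight (dual ν a) ≡ proj₁ (k zero)
      weight-dual = coordinate-elim ν _
        (λ i → trans (cong (λ b → weight (eIndex i) * weight b) (dual-e ν i)) (weight-ef i))
        (λ i → trans (cong (λ b → weight (fIndex i) * weight b) (dual-f ν i))
          (trans (*-comm _ _) (weight-ef i)))

      weight≢0 : ∀ a → weight a ≢ 0#
      weight≢0 a w≡0 = proj₂ (k zero)
        (trans (sym (weight-dual a)) (trans (cong (_* weight (dual ν a)) w≡0) (zeroˡ _)))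

      -- Identities between weights then need checking only on the e-coordinates and on the products
      -- over hyperbolic pairs, without handling the inverses in the f-weights.
      weight-unique : (w : Fin N → Carrier) → (∀ i → w (eIndex i) ≡ eWeight i) →
        (∀ (i : Fin ν) → w (eIndex i) * w (fIndex i) ≡ proj₁ (k zero)) → ∀ a → w a ≡ weight a
      weight-unique w w-e w-ef = coordinate-elim ν _
        (λ i → trans (w-e i) (sym (weight-e i)))
        (λ i → *-cancelˡ (eWeight≢0 i) (begin
          eWeight i * w (fIndex i)                      ≡⟨ cong (_* w (fIndex i)) (w-e i) ⟨
          w (eIndex i) * w (fIndex i)             ≡⟨ trans (w-ef i) (sym (weight-ef i)) ⟩
          weight (eIndex i) * weight (fIndex i)   ≡⟨ cong (_* weight (fIndex i)) (weight-e i) ⟩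
          eWeight i * weight (fIndex i)                 ∎))

    module FieldAutomorphism (π : Group.Carrier (AutField F)) where
      open IsRingHomomorphism (proj₂ π) public using (+-homo; *-homo; 0#-homo; 1#-homo; -‿homo)

      to from : Carrier → Carrier
      to   = Inverse.to (proj₁ π)
      from = Inverse.from (proj₁ π)

      to-from : ∀ x → to (from x) ≡ x
      to-from x = Inverse.inverseˡ (proj₁ π) refl

      from-to : ∀ x → from (to x) ≡ x
      from-to x = Inverse.inverseʳ (proj₁ π) refl

      from-*-homo : ∀ x y → from (x * y) ≡ from x * from y
      from-*-homo = IsRingHomomorphism.*-homo (proj₂ (Group._⁻¹ (AutField F) π))

      from-0 : from 0# ≡ 0#
      from-0 = IsRingHomomorphism.0#-homo (proj₂ (Group._⁻¹ (AutField F) π))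

      to≡0⇒≡0 : ∀ {x} → to x ≡ 0# → x ≡ 0#
      to≡0⇒≡0 {x} πx≡0 = trans (sym (from-to x)) (trans (cong from πx≡0) from-0)

      to-sum : ∀ {m} (f : Row F m) → to (sum f) ≡ sum (λ i → to (f i))
      to-sum {zero}  f = 0#-homo
      to-sum {suc m} f = trans (+-homo _ _) (cong (to (f zero) +_) (to-sum (λ i → f (suc i))))

      to-sgn : ∀ μ a → to (sgn μ a) ≡ sgn μ a
      to-sgn (suc μ) zero          = 1#-homo
      to-sgn (suc μ) (suc zero)    = trans (-‿homo 1#) (cong -_ 1#-homo)
      to-sgn (suc μ) (suc (suc a)) = to-sgn μ a

    module _ (k : Fin ν → Σ Carrier (_≢ 0#)) (π : Group.Carrier (AutField F)) where
      private
        module π = FieldAutomorphism π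

        w : Fin N → Carrier
        w = weight k

        w⁻¹ : Fin N → Carrier
        w⁻¹ a = inv (weight≢0 k a)

      semilinear semilinear⁻¹ : Row F N → Row F N
      semilinear α a = w a * π.to (α a)
      semilinear⁻¹ α a = π.from (w⁻¹ a * α a)

      -- Every term yields the same factor, since paired weights multiply to `k zero` and `π` fixes
      -- the signs 1 and -1 occurring in the form.
      semilinear-similitude : ∀ α β → form F ν (semilinear α) (semilinear β) ≡ proj₁ (k zero) * π.to (form F ν α β)
      semilinear-similitude α β = begin
        form F ν (semilinear α) (semilinear β)
          ≡⟨ form-dual ν (semilinear α) (semilinear β) ⟩
        sum (λ a → (w a * π.to (α a)) * (sgn ν a * (w (dual ν a) * π.to (β (dual ν a)))))
          ≡⟨ sum-cong-≗ term ⟩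
        sum (λ a → proj₁ (k zero) * π.to (α a * (sgn ν a * β (dual ν a))))
          ≡⟨ *-distribˡ-sum (proj₁ (k zero)) (λ a → π.to (α a * (sgn ν a * β (dual ν a)))) ⟨
        proj₁ (k zero) * sum (λ a → π.to (α a * (sgn ν a * β (dual ν a))))
          ≡⟨ cong (proj₁ (k zero) *_) (trans (cong π.to (form-dual ν α β)) (π.to-sum (λ a → α a * (sgn ν a * β (dual ν a))))) ⟨
        proj₁ (k zero) * π.to (form F ν α β) ∎
        where
        term : ∀ a → (w a * π.to (α a)) * (sgn ν a * (w (dual ν a) * π.to (β (dual ν a)))) ≡
                     proj₁ (k zero) * π.to (α a * (sgn ν a * β (dual ν a)))
        term a = begin
          (w a * π.to (α a)) * (sgn ν a * (w (dual ν a) * π.to (β (dual ν a))))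
            ≡⟨ [xy][z[wv]]≡[xw][y[zv]] _ _ _ _ _ ⟩
          (w a * w (dual ν a)) * (π.to (α a) * (sgn ν a * π.to (β (dual ν a))))
            ≡⟨ cong₂ (λ x s → x * (π.to (α a) * (s * π.to (β (dual ν a))))) (weight-dual k a) (sym (π.to-sgn ν a)) ⟩
          proj₁ (k zero) * (π.to (α a) * (π.to (sgn ν a) * π.to (β (dual ν a))))
            ≡⟨ cong (proj₁ (k zero) *_) (trans (π.*-homo _ _) (cong (π.to (α a) *_) (π.*-homo _ _))) ⟨
          proj₁ (k zero) * π.to (α a * (sgn ν a * β (dual ν a))) ∎

      semilinearCollineation : Collineation ν
      semilinearCollineation = record
        { θ = π.to ; θ⁻¹ = π.from ; θ-0 = π.0#-homo ; θ⁻¹-0 = π.from-0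
        ; g = semilinear ; g⁻¹ = semilinear⁻¹
        ; g-homo = λ α≡kβ a → trans (cong (w a *_) (trans (cong π.to (α≡kβ a)) (π.*-homo _ _))) (x*yz≡y*xz _ _ _)
        ; g⁻¹-homo = λ α≡kβ a → trans
            (cong π.from (trans (cong (w⁻¹ a *_) (α≡kβ a)) (x*yz≡y*xz _ _ _))) (π.from-*-homo _ _)
        ; g-g⁻¹ = λ α a → trans (cong (w a *_) (π.to-from _)) (inv-cancelʳ (weight≢0 k a) (α a))
        ; g⁻¹-g = λ α a → trans (cong π.from (inv-cancelˡ (weight≢0 k a) (π.to (α a)))) (π.from-to (α a))
        ; ⊥⇒⊥ = λ α β α⊥β → trans (semilinear-similitude α β)
            (trans (cong (proj₁ (k zero) *_) (trans (cong π.to α⊥β) π.0#-homo)) (zeroʳ _))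
        ; ⊥⇐⊥ = λ α β gα⊥gβ → π.to≡0⇒≡0
            (x*y≡0⇒y≡0 (proj₂ (k zero)) (trans (sym (semilinear-similitude α β)) gα⊥gβ))
        }

      semilinear-unit : ∀ a i → semilinear (unit F a) i ≡ w a * unit F a i
      semilinear-unit a i with a Fin.≟ i
      ... | yes refl = cong (w a *_) π.1#-homo
      ... | no _     = trans (cong (w i *_) π.0#-homo) (trans (zeroʳ _) (sym (zeroʳ _)))

      fromSemidirect : Group.Carrier (E F ν)
      fromSemidirect = Collineation.automorphism semilinearCollineation ,
        λ i → fixes (eIndex i) , fixes (fIndex i)
        where
        fixes : ∀ a → semilinear (unit F a) ≈ unit F a
        fixes a = proportional (weight≢0 k a) (semilinear-unit a)

    private
      G : Group c c
      G = F*^ F ν ⋊[ φ F ν ] AutField F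

    fromSemidirect-cong : ∀ (x y : Group.Carrier G) → Group._≈_ G x y →
      Group._≈_ (E F ν) (fromSemidirect (proj₁ x) (proj₂ x)) (fromSemidirect (proj₁ y) (proj₂ y))
    fromSemidirect-cong (k , π) (k′ , π′) (k≈k′ , π≈π′) (α , _) = ≗⇒≈ (λ a → cong₂ _*_
      (weight-unique k′ (weight k)
        (λ { zero → weight-e k zero ; (suc i) → trans (weight-e k (suc i)) (k≈k′ (suc i)) })
        (λ i → trans (weight-ef k i) (k≈k′ zero)) a)
      (π≈π′ (α a)))

    -- Moving the outer `π` past the inner weights turns `weight k′` into its image under `π`; this
    -- is the twist of the semidirect product.
    fromSemidirect-homo : ∀ (x y : Group.Carrier G) →
      Group._≈_ (E F ν) (fromSemidirect (proj₁ (Group._∙_ G x y)) (proj₂ (Group._∙_ G x y)))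
        (Group._∙_ (E F ν) (fromSemidirect (proj₁ x) (proj₂ x)) (fromSemidirect (proj₁ y) (proj₂ y)))
    fromSemidirect-homo x@(k , π) y@(k′ , π′) (α , _) = ≗⇒≈ (λ a → begin
      weight kk′ a * π.to (π′.to (α a))
        ≡⟨ cong (_* π.to (π′.to (α a))) (weight-unique kk′ (λ b → weight k b * π.to (weight k′ b)) e-eq ef-eq a) ⟨
      weight k a * π.to (weight k′ a) * π.to (π′.to (α a))
        ≡⟨ *-assoc _ _ _ ⟩
      weight k a * (π.to (weight k′ a) * π.to (π′.to (α a)))
        ≡⟨ cong (weight k a *_) (π.*-homo _ _) ⟨
      weight k a * π.to (weight k′ a * π′.to (α a)) ∎)
      where
      module π = FieldAutomorphism π
      module π′ = FieldAutomorphism π′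

      kk′ : Fin ν → Σ Carrier (_≢ 0#)
      kk′ = proj₁ (Group._∙_ G x y)

      e-eq : ∀ i → weight k (eIndex i) * π.to (weight k′ (eIndex i)) ≡ eWeight kk′ i
      e-eq zero    = trans (*-identityˡ _) π.1#-homo
      e-eq (suc i) = cong₂ (λ u v → u * π.to v) (weight-e k (suc i)) (weight-e k′ (suc i))

      ef-eq : ∀ (i : Fin ν) → weight k (eIndex i) * π.to (weight k′ (eIndex i)) *
        (weight k (fIndex i) * π.to (weight k′ (fIndex i))) ≡ proj₁ (kk′ zero)
      ef-eq i = trans ([xy][zw]≡[xz][yw] _ _ _ _)
        (cong₂ _*_ (weight-ef k i) (trans (sym (π.*-homo _ _)) (cong π.to (weight-ef k′ i))))

    -- Both maps keep first coordinate 1 on the test rows `vec₂`, so equality of lines becomes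
    -- equality of entries. Taking `t = 1` recovers the weights, and the entry at f₁ then recovers
    -- the field automorphism.
    fromSemidirect-injective : ∀ (x y : Group.Carrier G) →
      Group._≈_ (E F ν) (fromSemidirect (proj₁ x) (proj₂ x)) (fromSemidirect (proj₁ y) (proj₂ y)) → Group._≈_ G x y
    fromSemidirect-injective (k , π) (k′ , π′) eq = k≈k′ , π≈π′
      where
      module π = FieldAutomorphism π
      module π′ = FieldAutomorphism π′

      value : ∀ l τ i t → semilinear l τ (vec₂ ν zero (suc i) t) (suc i) ≡ weight l (suc i) * FieldAutomorphism.to τ t
      value l τ i t = cong (λ s → weight l (suc i) * FieldAutomorphism.to τ s) (vec₂-at₂ ν {zero} {suc i} t Fin.0≢1+n)

      value₀ : ∀ l τ i t → semilinear l τ (vec₂ ν zero (suc i) t) zero ≡ 1#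
      value₀ l τ i t = trans (*-identityˡ _) (trans
        (cong (FieldAutomorphism.to τ) (vec₂-at₁ ν {zero} {suc i} t Fin.0≢1+n))
        (FieldAutomorphism.1#-homo τ))

      same : ∀ i t → weight k (suc i) * π.to t ≡ weight k′ (suc i) * π′.to t
      same i t = begin
        weight k (suc i) * π.to t                               ≡⟨ *-identityʳ _ ⟨
        weight k (suc i) * π.to t * 1#                          ≡⟨ cong (weight k (suc i) * π.to t *_) (value₀ k′ π′ i t) ⟨
        weight k (suc i) * π.to t * semilinear k′ π′ (vec₂ ν zero (suc i) t) zero
          ≡⟨ ≈-ratio {α = semilinear k π (vec₂ ν zero (suc i) t)} {semilinear k′ π′ (vec₂ ν zero (suc i) t)}
               {zero} {suc i} {weight k (suc i) * π.to t}
               (eq (vec₂ᵥ ν {zero} {suc i} Fin.0≢1+n t))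
               (trans (value k π i t) (sym (trans (cong (weight k (suc i) * π.to t *_) (value₀ k π i t)) (*-identityʳ _)))) ⟨
        semilinear k′ π′ (vec₂ ν zero (suc i) t) (suc i)        ≡⟨ value k′ π′ i t ⟩
        weight k′ (suc i) * π′.to t                             ∎

      weights : ∀ i → weight k (suc i) ≡ weight k′ (suc i)
      weights i = trans (sym (trans (cong (weight k (suc i) *_) π.1#-homo) (*-identityʳ _)))
        (trans (same i 1#) (trans (cong (weight k′ (suc i) *_) π′.1#-homo) (*-identityʳ _)))

      k≈k′ : ∀ i → proj₁ (k i) ≡ proj₁ (k′ i)
      k≈k′ zero    = trans (sym (weight-ef k zero)) (trans (cong (1# *_) (weights zero)) (weight-ef k′ zero))
      k≈k′ (suc i) = trans (sym (weight-e k (suc i))) (trans (weights (suc (eIndex i))) (weight-e k′ (suc i)))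

      π≈π′ : ∀ t → π.to t ≡ π′.to t
      π≈π′ t = *-cancelˡ (weight≢0 k (suc zero)) (trans (same zero t) (cong (_* π′.to t) (sym (weights zero))))

  -- Rank at least two: recovering the scalars and the field automorphism.

  module HigherRank (n : ℕ) (σ : Group.Carrier (E F (suc (suc n)))) where
    open FirstCoordinate (suc n) σ

    private
      ν N : ℕ
      ν = suc (suc n)
      N = ν ℕ* 2

      V : Set c
      V = SimpleGraph.Vertex (SpGraph F ν)

      one : Fin N
      one = suc zero

      κ : Fin N → Carrier
      κ a = coordinateMap a 1#

      suc≢suc : ∀ {m} {i j : Fin m} → i ≢ j → suc i ≢ suc j
      suc≢suc i≢j = i≢j ∘ Fin.suc-injective

    module _ {i j : Fin (suc (suc n ℕ* 2))} (i≢j : i ≢ j) where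
      private
        vec : Carrier → Carrier → V
        vec = vec₃ᵥ ν {zero} {suc i} {suc j} Fin.0≢1+n Fin.0≢1+n (suc≢suc i≢j)

        module _ (s t : Carrier) where
          at₀ : proj₁ (vec s t) zero ≡ 1#
          at₀ = vec₃-at₁ ν {zero} {suc i} {suc j} s t Fin.0≢1+n Fin.0≢1+n (suc≢suc i≢j)

          at₀≢0 : proj₁ (vec s t) zero ≢ 0#
          at₀≢0 v₀≡0 = 1≢0 (trans (sym at₀) v₀≡0)

          at-i : proj₁ (vec s t) (suc i) ≡ s
          at-i = vec₃-at₂ ν {zero} {suc i} {suc j} s t Fin.0≢1+n Fin.0≢1+n (suc≢suc i≢j)

          at-j : proj₁ (vec s t) (suc j) ≡ t
          at-j = vec₃-at₃ ν {zero} {suc i} {suc j} s t Fin.0≢1+n Fin.0≢1+n (suc≢suc i≢j)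

          to-i : proj₁ (to (vec s t)) (suc i) ≡ coordinateMap (suc i) s * proj₁ (to (vec s t)) zero
          to-i = to-coordinate (vec s t) at₀≢0 {suc i} {s}
            (trans at-i (sym (trans (cong (s *_) at₀) (*-identityʳ s))))

          to-j : proj₁ (to (vec s t)) (suc j) ≡ coordinateMap (suc j) t * proj₁ (to (vec s t)) zero
          to-j = to-coordinate (vec s t) at₀≢0 {suc j} {t}
            (trans at-j (sym (trans (cong (t *_) at₀) (*-identityʳ t))))

      to-vec₃ : ∀ s t → proj₁ (to (vec s t)) ≈
        vec₃ ν zero (suc i) (suc j) (coordinateMap (suc i) s) (coordinateMap (suc j) t)
      to-vec₃ s t = proportional {α = x′} {v} {x′ zero} (to-≢0 (vec s t) zero (at₀≢0 s t)) agree
        where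
        x′ v : Row F N
        x′ = proj₁ (to (vec s t))
        v = vec₃ ν zero (suc i) (suc j) (coordinateMap (suc i) s) (coordinateMap (suc j) t)

        agree : ∀ m → x′ m ≡ x′ zero * v m
        agree zero = sym (trans (cong (x′ zero *_)
          (vec₃-at₁ ν {zero} {suc i} {suc j} _ _ Fin.0≢1+n Fin.0≢1+n (suc≢suc i≢j))) (*-identityʳ _))
        agree (suc m) = case ((i Fin.≟ m) , (j Fin.≟ m)) of λ
          { (yes refl , _) → trans (to-i s t) (trans (*-comm _ _) (cong (x′ zero *_)
              (sym (vec₃-at₂ ν {zero} {suc i} {suc j} _ _ Fin.0≢1+n Fin.0≢1+n (suc≢suc i≢j)))))
          ; (no _ , yes refl) → trans (to-j s t) (trans (*-comm _ _) (cong (x′ zero *_)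
              (sym (vec₃-at₃ ν {zero} {suc i} {suc j} _ _ Fin.0≢1+n Fin.0≢1+n (suc≢suc i≢j)))))
          ; (no i≢m , no j≢m) → trans
              (to-0 (vec s t) (suc m) (vec₃-off ν {zero} {suc i} {suc j} s t
                Fin.0≢1+n Fin.0≢1+n (suc≢suc i≢j) Fin.0≢1+n (suc≢suc i≢m) (suc≢suc j≢m)))
              (sym (trans (cong (x′ zero *_) (vec₃-off ν {zero} {suc i} {suc j} _ _
                Fin.0≢1+n Fin.0≢1+n (suc≢suc i≢j) Fin.0≢1+n (suc≢suc i≢m) (suc≢suc j≢m))) (zeroʳ _)))
          }

      -- In the row with entries 1, `s` and `s * t`, the last entry is `s * t` times the first and
      -- also `t` times the second; the images of the two relations must agree.
      cocycle : ∀ s t → coordinateMap (suc j) (s * t) ≡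
        ratio {suc i} {suc j} (suc≢suc i≢j) t * coordinateMap (suc i) s
      cocycle s t = *-cancelʳ (to-≢0 x zero (at₀≢0 s (s * t))) (begin
        coordinateMap (suc j) (s * t) * proj₁ (to x) zero    ≡⟨ to-j s (s * t) ⟨
        proj₁ (to x) (suc j)
          ≡⟨ to-ratio {suc i} {suc j} (suc≢suc i≢j) t x (trans (at-j s (s * t))
               (trans (*-comm s t) (cong (t *_) (sym (at-i s (s * t)))))) ⟩
        ρ * proj₁ (to x) (suc i)                             ≡⟨ cong (ρ *_) (to-i s (s * t)) ⟩
        ρ * (coordinateMap (suc i) s * proj₁ (to x) zero)    ≡⟨ *-assoc _ _ _ ⟨
        ρ * coordinateMap (suc i) s * proj₁ (to x) zero      ∎)
        where
        x = vec s (s * t)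
        ρ = ratio {suc i} {suc j} (suc≢suc i≢j) t

    -- The sign condition lets `p` be an e-coordinate of a later pair, so that this pair contributes
    -- `k * w` to the form with a plus sign.
    module _ (p : Fin (suc n ℕ* 2)) (sgn≡1 : sgn (suc n) p ≡ 1#) where
      private
        b b* : Fin N
        b  = suc (suc p)
        b* = suc (suc (dual (suc n) p))

        vec₃-form : ∀ s k u w →
          form F ν (vec₃ ν zero one b s k) (vec₃ ν zero one b* u w) ≡ k * w + (u + - s)
        vec₃-form s k u w = begin
          form F ν (vec₃ ν zero one b s k) v
            ≡⟨ form-addˡ ν k b (vec₂ ν zero one s) v ⟩
          k * (sgn (suc n) p * v b*) + form F ν (vec₂ ν zero one s) v
            ≡⟨ cong₂ _+_
                 (cong (k *_) (trans (cong₂ _*_ sgn≡1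
                   (vec₃-at₃ ν {zero} {one} {b*} u w Fin.0≢1+n Fin.0≢1+n (suc≢suc Fin.0≢1+n))) (*-identityˡ w)))
                 (trans (form-addˡ ν s one (unit F zero) v) (+-comm _ _)) ⟩
          k * w + (form F ν (unit F zero) v + s * (- 1# * v zero))
            ≡⟨ cong (k * w +_) (cong₂ _+_
                 (trans (form-unitˡ ν zero v) (trans (*-identityˡ _)
                   (vec₃-at₂ ν {zero} {one} {b*} u w Fin.0≢1+n Fin.0≢1+n (suc≢suc Fin.0≢1+n))))
                 (trans (cong (s *_) (trans (-1*x _) (cong -_
                   (vec₃-at₁ ν {zero} {one} {b*} u w Fin.0≢1+n Fin.0≢1+n (suc≢suc Fin.0≢1+n)))))
                   (trans (sym (-‿distribʳ-* s 1#)) (cong -_ (*-identityʳ s))))) ⟩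
          k * w + (u + - s) ∎
          where
          v = vec₃ ν zero one b* u w

      -- Orthogonality of the vectors e₁ + s f₁ + b and e₁ + u f₁ + w e*.
      additivity : ∀ {s u w} → w + u ≡ s →
        κ b * coordinateMap b* w + coordinateMap one u ≡ coordinateMap one s
      additivity {s} {u} {w} w+u≡s = x-y≡0⇒x≡y (begin
        κ b * coordinateMap b* w + coordinateMap one u + - coordinateMap one s
          ≡⟨ +-assoc _ _ _ ⟩
        κ b * coordinateMap b* w + (coordinateMap one u + - coordinateMap one s)
          ≡⟨ vec₃-form (coordinateMap one s) (κ b) (coordinateMap one u) (coordinateMap b* w) ⟨
        form F ν X Y
          ≡⟨ form-∈ˡ F ν {α = X} {proj₁ (to x)} {Y} (≈⇒∈ (≈-sym (to-vec₃ {zero} {suc p} Fin.0≢1+n s 1#)))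
               (form-∈ʳ F ν {α = proj₁ (to x)} {Y} {proj₁ (to y)}
                 (≈⇒∈ (≈-sym (to-vec₃ {zero} {suc (dual (suc n) p)} Fin.0≢1+n u w)))
                 (to-⊥ x y (trans (vec₃-form s 1# u w) (trans (sym (+-assoc _ _ _))
                   (x≡y⇒x-y≡0 (trans (cong (_+ u) (*-identityˡ w)) w+u≡s)))))) ⟩
        0# ∎)
        where
        x y : V
        x = vec₃ᵥ ν {zero} {one} {b} Fin.0≢1+n Fin.0≢1+n (suc≢suc Fin.0≢1+n) s 1#
        y = vec₃ᵥ ν {zero} {one} {b*} Fin.0≢1+n Fin.0≢1+n (suc≢suc Fin.0≢1+n) u w

        X Y : Row F N
        X = vec₃ ν zero one b (coordinateMap one s) (κ b)
        Y = vec₃ ν zero one b* (coordinateMap one u) (coordinateMap b* w)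

      -- The case `w = s = 1`, `u = 0` of `additivity`. It identifies `κ one` as the common
      -- multiplier of all hyperbolic pairs.
      κ-dual : κ b * κ b* ≡ κ one
      κ-dual = trans (sym (trans (cong (κ b * κ b* +_) (coordinateMap-0 one)) (+-identityʳ _)))
        (additivity (+-identityʳ 1#))

    private
      κ₁≢0 : κ one ≢ 0#
      κ₁≢0 = coordinateMap-1≢0 one

      π : Carrier → Carrier
      π t = inv κ₁≢0 * coordinateMap one t

      -- `cocycle` based at f₁ with ratio 1 makes every other coordinate map a constant multiple of
      -- the one at f₁; evaluating at 1 gives the constant.
      scale : ∀ i t → coordinateMap (suc i) t ≡ κ (suc i) * π t
      scale zero    t = sym (inv-cancelʳ κ₁≢0 _)
      scale (suc i) t = *-cancelˡ κ₁≢0 (begin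
        κ one * coordinateMap (suc (suc i)) t             ≡⟨ cong (λ z → κ one * coordinateMap (suc (suc i)) z) (*-identityʳ t) ⟨
        κ one * coordinateMap (suc (suc i)) (t * 1#)      ≡⟨ cong (κ one *_) (cocycle {zero} {suc i} Fin.0≢1+n t 1#) ⟩
        κ one * (ρ * coordinateMap one t)                 ≡⟨ x*yz≡y*xz _ _ _ ⟩
        ρ * (κ one * coordinateMap one t)                 ≡⟨ *-assoc _ _ _ ⟨
        ρ * κ one * coordinateMap one t
          ≡⟨ cong₂ _*_ (trans (sym (cocycle {zero} {suc i} Fin.0≢1+n 1# 1#)) (cong (coordinateMap (suc (suc i))) (*-identityʳ 1#)))
               (sym (inv-cancelʳ κ₁≢0 _)) ⟩
        κ (suc (suc i)) * (κ one * π t)                   ≡⟨ x*yz≡y*xz _ _ _ ⟩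
        κ one * (κ (suc (suc i)) * π t)                   ∎)
        where
        ρ = ratio {suc zero} {suc (suc i)} (suc≢suc Fin.0≢1+n) 1#

      π-0 : π 0# ≡ 0#
      π-0 = trans (cong (inv κ₁≢0 *_) (coordinateMap-0 one)) (zeroʳ _)

      π-1 : π 1# ≡ 1#
      π-1 = invˡ κ₁≢0

      -- Here a coordinate beyond the first pair enters, namely e₂: `cocycle` from f₁ to e₂
      -- separates the factors `s` and `t`, and its instance at `s = 1` evaluates the ratio.
      π-* : ∀ s t → π (s * t) ≡ π s * π t
      π-* s t = *-cancelˡ (coordinateMap-1≢0 two) (begin
        κ two * π (s * t)                ≡⟨ scale (suc zero) (s * t) ⟨
        coordinateMap two (s * t)        ≡⟨ cocycle {zero} {suc zero} Fin.0≢1+n s t ⟩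
        ρ * coordinateMap one s          ≡⟨ cong (ρ *_) (scale zero s) ⟩
        ρ * (κ one * π s)                ≡⟨ *-assoc _ _ _ ⟨
        ρ * κ one * π s                  ≡⟨ cong (_* π s) (cocycle {zero} {suc zero} Fin.0≢1+n 1# t) ⟨
        coordinateMap two (1# * t) * π s ≡⟨ cong (λ z → coordinateMap two z * π s) (*-identityˡ t) ⟩
        coordinateMap two t * π s        ≡⟨ cong (_* π s) (scale (suc zero) t) ⟩
        κ two * π t * π s                ≡⟨ *-assoc _ _ _ ⟩
        κ two * (π t * π s)              ≡⟨ cong (κ two *_) (*-comm _ _) ⟩
        κ two * (π s * π t)              ∎)
        where
        two : Fin N
        two = suc (suc zero)
        ρ = ratio {suc zero} {suc (suc zero)} (suc≢suc Fin.0≢1+n) t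

      π-+ : ∀ s t → π (s + t) ≡ π s + π t
      π-+ s t = *-cancelˡ κ₁≢0 (begin
        κ one * π (s + t)                                   ≡⟨ scale zero (s + t) ⟨
        coordinateMap one (s + t)                           ≡⟨ additivity zero refl refl ⟨
        κ b * coordinateMap b* s + coordinateMap one t      ≡⟨ cong₂ _+_ (cong (κ b *_) (scale (suc (suc zero)) s)) (scale zero t) ⟩
        κ b * (κ b* * π s) + κ one * π t                    ≡⟨ cong (_+ κ one * π t) (*-assoc _ _ _) ⟨
        κ b * κ b* * π s + κ one * π t                      ≡⟨ cong (λ z → z * π s + κ one * π t) (κ-dual zero refl) ⟩
        κ one * π s + κ one * π t                           ≡⟨ distribˡ _ _ _ ⟨
        κ one * (π s + π t)                                 ∎)
        where
        b b* : Fin N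
        b  = suc (suc zero)
        b* = suc (suc (suc zero))

      π-neg : ∀ t → π (- t) ≡ - π t
      π-neg t = +-cancelˡ (π t) _ _ (trans (sym (π-+ t (- t)))
        (trans (cong π (-‿inverseʳ t)) (trans π-0 (sym (-‿inverseʳ (π t))))))

    fieldAutomorphism : Group.Carrier (AutField F)
    fieldAutomorphism = scaling ↔-∘ coordinatePermutation (suc n) σ zero , record
      { isSemiringHomomorphism = record
        { isNearSemiringHomomorphism = record
          { +-isMonoidHomomorphism = record
            { isMagmaHomomorphism = record
              { isRelHomomorphism = record { cong = cong π }
              ; homo = π-+
              }
            ; ε-homo = π-0
            }
          ; *-homo = π-*
          }
        ; 1#-homo = π-1
        }
      ; -‿homo = π-neg
      }
      where
      scaling : Carrier ↔ Carrier
      scaling = mk↔ₛ′ (inv κ₁≢0 *_) (κ one *_) (inv-cancelˡ κ₁≢0) (inv-cancelʳ κ₁≢0)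

    scalars : Fin ν → Σ Carrier (_≢ 0#)
    scalars zero    = κ one , κ₁≢0
    scalars (suc i) = κ (eIndex (suc i)) , coordinateMap-1≢0 (eIndex (suc i))

    private
      open Semilinear (suc n)

      κ-e : ∀ i → κ (eIndex i) ≡ eWeight scalars i
      κ-e zero    = refl
      κ-e (suc i) = refl

      κ-ef : ∀ (i : Fin ν) → κ (eIndex i) * κ (fIndex i) ≡ κ one
      κ-ef zero    = *-identityˡ _
      κ-ef (suc i) = subst (λ a → κ (suc (suc (eIndex i))) * κ (suc (suc a)) ≡ κ one)
        (dual-e (suc n) i) (κ-dual (eIndex i) (sgn-e (suc n) i))

      κ≡weight : ∀ a → κ a ≡ weight scalars a
      κ≡weight = weight-unique scalars κ κ-e κ-ef

      module _ (x : V) where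
        v v′ s : Row F N
        v  = proj₁ x
        v′ = proj₁ (to x)
        s a = κ a * π (v a)

        cross-0 : v zero ≢ 0# → ∀ a → s a * v′ zero ≡ s zero * v′ a
        cross-0 v₀≢0 zero    = refl
        cross-0 v₀≢0 (suc i) = begin
          κ (suc i) * π (v (suc i)) * v′ zero
            ≡⟨ cong (λ z → κ (suc i) * π z * v′ zero) (inv-cancelʳ v₀≢0 _) ⟨
          κ (suc i) * π (v zero * q) * v′ zero
            ≡⟨ cong (λ z → κ (suc i) * z * v′ zero) (π-* (v zero) q) ⟩
          κ (suc i) * (π (v zero) * π q) * v′ zero
            ≡⟨ [x[yz]]w≡y[[xz]w] _ _ _ _ ⟩
          π (v zero) * (κ (suc i) * π q * v′ zero)
            ≡⟨ cong (λ z → π (v zero) * (z * v′ zero)) (scale i q) ⟨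
          π (v zero) * (coordinateMap (suc i) q * v′ zero)
            ≡⟨ cong₂ _*_ (*-identityˡ _) (to-coordinate x v₀≢0 {suc i} {q}
                 (trans (sym (inv-cancelʳ v₀≢0 _)) (*-comm _ _))) ⟨
          s zero * v′ (suc i) ∎
          where
          q = inv v₀≢0 * v (suc i)

        -- On the hyperplane of first coordinate 0 the maps `coordinateMap` do not apply directly. A
        -- nonzero coordinate `j` serves as base, and `cocycle` at `s = 1` expresses the ratio from
        -- `j` to `i` through `coordinateMap`.
        cross-suc : ∀ j → v zero ≡ 0# → v (suc j) ≢ 0# → ∀ a → s a * v′ (suc j) ≡ s (suc j) * v′ a
        cross-suc j v₀≡0 vⱼ≢0 zero = trans
          (trans (cong (_* v′ (suc j)) (trans (*-identityˡ _) (trans (cong π v₀≡0) π-0))) (zeroˡ _))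
          (sym (trans (cong (s (suc j) *_) (to-0 x zero v₀≡0)) (zeroʳ _)))
        cross-suc j v₀≡0 vⱼ≢0 (suc i) = case j Fin.≟ i of λ { (yes refl) → refl ; (no j≢i) → off j≢i }
          where
          q = inv vⱼ≢0 * v (suc i)

          off : j ≢ i → s (suc i) * v′ (suc j) ≡ s (suc j) * v′ (suc i)
          off j≢i = begin
            κ (suc i) * π (v (suc i)) * v′ (suc j)
              ≡⟨ cong (λ z → κ (suc i) * π z * v′ (suc j)) (inv-cancelʳ vⱼ≢0 _) ⟨
            κ (suc i) * π (v (suc j) * q) * v′ (suc j)
              ≡⟨ cong (λ z → κ (suc i) * z * v′ (suc j)) (π-* (v (suc j)) q) ⟩
            κ (suc i) * (π (v (suc j)) * π q) * v′ (suc j)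
              ≡⟨ [x[yz]]w≡y[[xz]w] _ _ _ _ ⟩
            π (v (suc j)) * (κ (suc i) * π q * v′ (suc j))
              ≡⟨ cong (λ z → π (v (suc j)) * (z * v′ (suc j))) (scale i q) ⟨
            π (v (suc j)) * (coordinateMap (suc i) q * v′ (suc j))
              ≡⟨ cong (λ z → π (v (suc j)) * (z * v′ (suc j)))
                   (trans (sym (cocycle {j} {i} j≢i 1# q)) (cong (coordinateMap (suc i)) (*-identityˡ q))) ⟨
            π (v (suc j)) * (ρ * κ (suc j) * v′ (suc j))
              ≡⟨ x[[yz]w]≡[zx][yw] _ _ _ _ ⟩
            κ (suc j) * π (v (suc j)) * (ρ * v′ (suc j))
              ≡⟨ cong (s (suc j) *_) (to-ratio {suc j} {suc i} (suc≢suc j≢i) q x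
                   (trans (sym (inv-cancelʳ vⱼ≢0 _)) (*-comm _ _))) ⟨
            s (suc j) * v′ (suc i) ∎
            where
            ρ = ratio {suc j} {suc i} (suc≢suc j≢i) q

    fromSemidirect-surjective : Group._≈_ (E F ν) (fromSemidirect scalars fieldAutomorphism) σ
    fromSemidirect-surjective x = ≈-trans {α = semilinear scalars fieldAutomorphism (v x)} {s x} {v′ x}
      (≗⇒≈ (λ a → cong (_* π (v x a)) (sym (κ≡weight a))))
      (case v x zero ≟ 0# of λ
        { (yes v₀≡0) → case pivot (proj₂ x) of λ
            { (zero , v₀≢0)  → contradiction v₀≡0 v₀≢0
            ; (suc j , vⱼ≢0) → cross⇒≈ (suc j) (s≢0 vⱼ≢0) (to-≢0 x (suc j) vⱼ≢0) (cross-suc x j v₀≡0 vⱼ≢0) }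
        ; (no v₀≢0) → cross⇒≈ zero (s≢0 v₀≢0) (to-≢0 x zero v₀≢0) (cross-0 x v₀≢0) })
      where
      s≢0 : ∀ {a} → v x a ≢ 0# → s x a ≢ 0#
      s≢0 {a} va≢0 = *-≢0 F (coordinateMap-1≢0 a)
        (λ πva≡0 → va≢0 (FieldAutomorphism.to≡0⇒≡0 fieldAutomorphism πva≡0))

-- Isomorphisms obtained from a map in the opposite direction.

module _ {a b ℓ₁ ℓ₂} (G : Group a ℓ₁) (H : Group b ℓ₂) where
  private
    module G = Group G
    module H = Group H
    open GroupMorphisms G.rawGroup H.rawGroup using (IsGroupIsomorphism)

  -- Permutations and pairs of scalars with a field automorphism give automorphisms by explicit
  -- formulas, so this is the direction that is easy to define. Injectivity of `ψ` transfers the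
  -- group laws to the chosen preimages.
  inverse-isomorphism : (ψ : H.Carrier → G.Carrier) →
    (∀ x y → x H.≈ y → ψ x G.≈ ψ y) → (∀ x y → ψ (x H.∙ y) G.≈ ψ x G.∙ ψ y) →
    (∀ x y → ψ x G.≈ ψ y → x H.≈ y) → (∀ g → ∃ λ x → ψ x G.≈ g) → G ≅ H
  inverse-isomorphism ψ ψ-cong ψ-homo ψ-injective ψ-surjective = ϕ , record
    { isGroupMonomorphism = record
      { isGroupHomomorphism = record
        { isMonoidHomomorphism = record
          { isMagmaHomomorphism = record
            { isRelHomomorphism = record
              { cong = λ {g} {h} g≈h → ψ-injective _ _ (G.trans (ψϕ g) (G.trans g≈h (G.sym (ψϕ h)))) }
            ; homo = λ g h → ψ-injective _ _ (G.trans (ψϕ (g G.∙ h))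
                (G.sym (G.trans (ψ-homo (ϕ g) (ϕ h)) (G.∙-cong (ψϕ g) (ψϕ h)))))
            }
          ; ε-homo = ψ-injective _ _ (G.trans (ψϕ G.ε) (G.sym ψ-ε))
          }
        ; ⁻¹-homo = λ g → ψ-injective _ _ (G.trans (ψϕ (g G.⁻¹))
            (G.sym (G.trans (ψ-⁻¹ (ϕ g)) (G.⁻¹-cong (ψϕ g)))))
        }
      ; injective = λ {g} {h} ϕg≈ϕh → G.trans (G.sym (ψϕ g)) (G.trans (ψ-cong _ _ ϕg≈ϕh) (ψϕ h))
      }
    ; surjective = λ x → ψ x , λ {g} g≈ψx → ψ-injective _ _ (G.trans (ψϕ g) g≈ψx)
    }
    where
    ϕ : G.Carrier → H.Carrier
    ϕ g = proj₁ (ψ-surjective g)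

    ψϕ : ∀ g → ψ (ϕ g) G.≈ g
    ψϕ g = proj₂ (ψ-surjective g)

    ψ-ε : ψ H.ε G.≈ G.ε
    ψ-ε = GroupProperties.identityʳ-unique G (ψ H.ε) (ψ H.ε)
      (G.trans (G.sym (ψ-homo H.ε H.ε)) (ψ-cong _ _ (H.identityˡ H.ε)))

    ψ-⁻¹ : ∀ x → ψ (x H.⁻¹) G.≈ ψ x G.⁻¹
    ψ-⁻¹ x = GroupProperties.inverseˡ-unique G (ψ (x H.⁻¹)) (ψ x)
      (G.trans (G.sym (ψ-homo (x H.⁻¹) x)) (G.trans (ψ-cong _ _ (H.inverseˡ x)) ψ-ε))

theorem3p4 : ∀ {c} (q : ℕ) → IsPrimePower q → 2 < q →
    (F : Field c) → Fin q ↔ Field.Carrier F →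
    (ν : ℕ) → 1 ≤ ν →
    ((σ : Group.Carrier (Aut-Sp F ν)) → ∃₂ λ ρ τ → PSp F ν ρ × FixesBasis F ν τ ×
    Group._≈_ (Aut-Sp F ν) σ (Group._∙_ (Aut-Sp F ν) ρ τ)) ×
    (ν ≡ 1 → E F ν ≅ Sym (setoid (Fin (q ∸ 1)))) ×
    (1 < ν → E F ν ≅ (F*^ F ν ⋊[ φ F ν ] AutField F))
theorem3p4 zero _ () _ _ _ _
theorem3p4 {c} (suc m) _ _ F enum ν _ = symplectic-decomposition ν , rankOne , higherRank
  where
  _≟_ : DecidableEquality (Field.Carrier F)
  _≟_ = via-injection (↔⇒↣ (↔-sym enum)) Fin._≟_

  open SymplecticSpace F _≟_

  rankOne : ν ≡ 1 → E F ν ≅ Sym (setoid (Fin m))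
  rankOne refl = inverse-isomorphism (E F 1) (Sym (setoid (Fin m)))
    (fromSym enum₀ enum₀-0) (fromSym-cong enum₀ enum₀-0) (fromSym-homo enum₀ enum₀-0)
    (fromSym-injective enum₀ enum₀-0) (fromSym-surjective enum₀ enum₀-0)
    where
    open RankOne

    -- The transposition moves `0#` to index `zero`, leaving the remaining q - 1 indices for the
    -- nonzero elements.
    enum₀ : Fin (suc m) ↔ Field.Carrier F
    enum₀ = enum ↔-∘ transpose zero (Inverse.from enum (Field.0# F))

    enum₀-0 : Inverse.to enum₀ zero ≡ Field.0# F
    enum₀-0 = Inverse.inverseˡ enum refl

  higherRank : 1 < ν → E F ν ≅ (F*^ F ν ⋊[ φ F ν ] AutField F)
  higherRank (s≤s (s≤s {n = n} z≤n)) = inverse-isomorphism (E F (suc (suc n)))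
    (F*^ F (suc (suc n)) ⋊[ φ F (suc (suc n)) ] AutField F)
    (λ x → fromSemidirect (proj₁ x) (proj₂ x)) fromSemidirect-cong fromSemidirect-homo fromSemidirect-injective
    (λ σ → (HigherRank.scalars n σ , HigherRank.fieldAutomorphism n σ) , HigherRank.fromSemidirect-surjective n σ)
    where
    open Semilinear (suc n)
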